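{- The online algorithm DistProb is $4$-competitive for online facility location with uniform facility cost in the random-order model; that is, for every input instance $\mathcal{I}=(M,d,U)$, $\mathrm{E}[\mathrm{ALG}(\mathcal{I})]\le 4\cdot \mathrm{OPT}(\mathcal{I})$, where $\mathrm{ALG}(\mathcal{I})$ is the total cost of DistProb on $\mathcal{I}$ and the expectation is over the uniformly random arrival order and the coin flips of the algorithm.
   Context: Facility location: $(M,d)$ is a metric space, $U$ is a (finite, nonempty) multiset of $n$ demand points in $M$ (copies are treated as distinct demands). A facility may be opened at any point of $M$ at cost $f$; by scaling, $f=1$. For $F\subseteq M$, $d(F,v)=\min_{u\in F}d(u,v)$ and $d(\emptyset,v)=\infty$. The cost of a set of facilities $F\subseteq M$ is $|F|+\sum_{v\in U}d(F,v)$; $\mathrm{OPT}(\mathcal{I})$ is the cost of an optimal (minimum cost) solution, which is taken to exist. Random-order online model: the demands arrive as a uniformly random permutation $v_1,\dots,v_n$ of $U$. When $v_\ell$ arrives the algorithm immediately and irrevocably decides whether and where to open new facilities, and then $v_\ell$ is irrevocably assigned to its nearest open facility. With $F_\ell$ the set of facilities opened by the end of round $\ell$ ($F_0=\emptyset$), the total cost is $|F_n|+\sum_{\ell=1}^n d(F_\ell,v_\ell)$. DistProb: when $v_\ell$ arrives, with probability $\min\{d(F_{\ell-1},v_\ell),1\}$ (fresh independent coin) set $F_\ell=F_{\ell-1}\cup\{v_\ell\}$ (paying $1$ for opening a facility at $v_\ell$), otherwise set $F_\ell=F_{\ell-1}$; assign $v_\ell$ to its nearest facility in $F_\ell$. 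-}

module Defs where

open import Level using (Level; _⊔_) renaming (suc to lsuc)
open import Algebra.Apartness.Structures using (IsHeytingField)
open import Algebra.Bundles using (CommutativeRing)
open import Algebra.Core using (Op₁; Op₂)
import Algebra.Definitions.RawMonoid as RawMonoidDefinitions
open import Data.Bool.Base using (Bool; true; false; if_then_else_)
open import Data.Fin.Base using (Fin; zero; suc; punchIn)
open import Data.Fin.Permutation as Perm
  using (Permutation′; _⟨$⟩ʳ_; insert; remove; insert-punchIn; punchIn-permute)
open import Data.List.Base
  using (List; []; _∷_; [_]; map; foldr; length; concatMap; allFin; tabulate)
open import Data.List.Properties using (length-++; length-map; length-tabulate)
open import Data.List.Relation.Unary.Any as Any using (Any; here)
open import Data.List.Relation.Unary.Any.Properties using (concatMap⁺; map⁺)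
open import Data.List.Membership.Propositional.Properties using (∈-allFin)
import Data.List.Relation.Unary.Unique.Setoid as UniqueSetoid
open import Data.Maybe.Base using (zipWith)
open import Data.Nat.Base as ℕ using (ℕ; zero; suc; NonZero; _!)
open import Data.Nat.Properties using (_!≢0)
open import Data.Product.Base using (_×_; _,_; proj₁)
open import Data.Sum.Base using (_⊎_; inj₂)
open import Function.Base using (id)
open import Function.Metric.Structures using (IsGeneralMetric)
open import Relation.Binary.Bundles using (Setoid)
open import Relation.Binary.Core using (Rel)
open import Relation.Binary.Lattice.Structures using (IsMeetSemilattice)
open import Relation.Binary.PropositionalEquality
  using (_≡_; refl; sym; trans; cong; cong₂)
open import Relation.Binary.Structures using (IsStrictPartialOrder)
open import Relation.Nullary.Construct.Add.Supremum using (_⁺; ⊤⁺) renaming ([_] to fin)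
import Relation.Binary.Construct.Add.Supremum.NonStrict as Supremum
open import Relation.Nullary.Negation.Core using (¬_)

private variable
  a b c ℓ ℓ₁ ℓ₂ : Level

-- Scalars.  There are no real numbers in the library, so distances, costs and
-- probabilities live in an arbitrary ordered field.  Totality of the order is
-- deliberately not assumed: with _≤_ the negation of the converse of _<_, the
-- axioms hold for the constructive reals, and for a decidable order they are
-- those of a linearly ordered field.

record OrderedField c ℓ₁ ℓ₂ : Set (lsuc (c ⊔ ℓ₁ ⊔ ℓ₂)) where
  infix  8 -_
  infixl 7 _*_ _⊓_
  infixl 6 _+_
  infix  4 _≈_ _<_ _≤_ _#_
  field
    Carrier : Set c
    _≈_     : Rel Carrier ℓ₁
    _<_     : Rel Carrier ℓ₂
    _+_     : Op₂ Carrier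
    _*_     : Op₂ Carrier
    _⊓_     : Op₂ Carrier
    -_      : Op₁ Carrier
    0#      : Carrier
    1#      : Carrier

  _≤_ : Rel Carrier ℓ₂
  x ≤ y = ¬ (y < x)

  _#_ : Rel Carrier ℓ₂
  x # y = x < y ⊎ y < x

  field
    isHeytingField       : IsHeytingField _≈_ _#_ _+_ _*_ -_ 0# 1#
    isStrictPartialOrder : IsStrictPartialOrder _≈_ _<_
    isMeetSemilattice    : IsMeetSemilattice _≈_ _≤_ _⊓_
    0<1                  : 0# < 1#
    +-monoˡ-<            : ∀ {x y} z → x < y → x + z < y + z
    *-pos                : ∀ {x y} → 0# < x → 0# < y → 0# < x * y

  commutativeRing : CommutativeRing c ℓ₁
  commutativeRing = record
    { isCommutativeRing = IsHeytingField.isCommutativeRing isHeytingField }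

  open CommutativeRing commutativeRing public
    using (_-_; +-rawMonoid)
  open RawMonoidDefinitions +-rawMonoid using () renaming (_×_ to _times_)

  fromℕ : ℕ → Carrier
  fromℕ n = n times 1#

  private
    module R = CommutativeRing commutativeRing
    module < = IsStrictPartialOrder isStrictPartialOrder

  0<fromℕ : ∀ n .{{_ : NonZero n}} → 0# < fromℕ n
  0<fromℕ 1                 = <.<-respʳ-≈ (R.sym (R.+-identityʳ 1#)) 0<1
  0<fromℕ (suc n@(suc _)) =
    <.trans (0<fromℕ n) (<.<-respˡ-≈ (R.+-identityˡ _) (+-monoˡ-< (fromℕ n) 0<1))

  1/_ : ∀ n .{{_ : NonZero n}} → Carrier
  1/ n = proj₁ (IsHeytingField.#⇒invertible isHeytingField (inj₂ (0<fromℕ n)))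

  -- Scalars extended by the top element ∞ = ⊤⁺.

  infixl 7 _·⁺_ _⊓⁺_
  infixl 6 _+⁺_

  _+⁺_ : Op₂ (Carrier ⁺)
  _+⁺_ = zipWith _+_

  _⊓⁺_ : Op₂ (Carrier ⁺)
  ⊤⁺    ⊓⁺ y     = y
  fin x ⊓⁺ ⊤⁺    = fin x
  fin x ⊓⁺ fin y = fin (x ⊓ y)

  -- Even 0# ·⁺ ⊤⁺ is ⊤⁺.  This affects no expectation below, since DistProb
  -- opens a facility at its first demand in every listed outcome.
  _·⁺_ : Carrier → Carrier ⁺ → Carrier ⁺
  k ·⁺ ⊤⁺    = ⊤⁺
  k ·⁺ fin x = fin (k * x)

  open Supremum _≤_ public using (_≤⁺_)


-- All n ! permutations, each listed once.

permutations : ∀ n → List (Permutation′ n)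
permutations zero    = [ Perm.id ]
permutations (suc n) =
  concatMap (λ j → map (insert zero j) (permutations n)) (allFin (suc n))

length-concatMap : ∀ {A : Set a} {B : Set b} (f : A → List B) {k} →
                   (∀ x → length (f x) ≡ k) → ∀ xs → length (concatMap f xs) ≡ length xs ℕ.* k
length-concatMap f eq []       = refl
length-concatMap f eq (x ∷ xs) =
  trans (length-++ (f x)) (cong₂ ℕ._+_ (eq x) (length-concatMap f eq xs))

length-permutations : ∀ n → length (permutations n) ≡ n !
length-permutations zero    = refl
length-permutations (suc n) = trans
  (length-concatMap (λ j → map (insert zero j) (permutations n))
    (λ j → trans (length-map (insert zero j) (permutations n)) (length-permutations n))
    (allFin (suc n)))
  (cong (ℕ._* n !) (length-tabulate {n = suc n} id))

permutations-complete : ∀ n (π : Permutation′ n) → Any (π Perm.≈_) (permutations n)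
permutations-complete zero    π = here λ ()
permutations-complete (suc n) π =
  concatMap⁺ _ (Any.map
    (λ { refl → map⁺ (Any.map step (permutations-complete n (remove zero π))) })
    (∈-allFin (π ⟨$⟩ʳ zero)))
  where
  step : ∀ {ρ} → remove zero π Perm.≈ ρ → π Perm.≈ insert zero (π ⟨$⟩ʳ zero) ρ
  step     eq zero    = refl
  step {ρ} eq (suc k) = trans (punchIn-permute π zero k)
    (trans (cong (punchIn (π ⟨$⟩ʳ zero)) (eq k)) (sym (insert-punchIn zero _ ρ k)))


-- Finitely supported distributions, as lists of weighted outcomes.  The type
-- does not enforce it, but return, coin (at δ ≥ 0) and uniformPermutation have
-- nonnegative weights with sum 1, and _>>=_ preserves this.

module Probability (K : OrderedField c ℓ₁ ℓ₂) where
  open OrderedField K renaming (Carrier to 𝕂)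

  Dist : Set a → Set (c ⊔ a)
  Dist A = List (𝕂 × A)

  return : ∀ {A : Set a} → A → Dist A
  return x = [ 1# , x ]

  infixl 1 _>>=_
  _>>=_ : ∀ {A : Set a} {B : Set b} → Dist A → (A → Dist B) → Dist B
  m >>= f = concatMap (λ (p , x) → map (λ (q , y) → p * q , y) (f x)) m

  𝔼 : Dist (𝕂 ⁺) → 𝕂 ⁺
  𝔼 = foldr (λ (p , x) s → p ·⁺ x +⁺ s) (fin 0#)

  uniformPermutation : ∀ n → Dist (Permutation′ n)
  uniformPermutation n = map ((1/ (n !)) {{n !≢0}} ,_) (permutations n)

  -- Heads with probability min {δ , 1}; for δ = ∞ this is 1, and the
  -- impossible outcome is left out.
  coin : 𝕂 ⁺ → Dist Bool
  coin ⊤⁺      = return true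
  coin (fin δ) = (δ ⊓ 1# , true) ∷ (1# - (δ ⊓ 1#) , false) ∷ []


record MetricSpace (K : OrderedField c ℓ₁ ℓ₂) a ℓ : Set (c ⊔ ℓ₁ ⊔ ℓ₂ ⊔ lsuc (a ⊔ ℓ)) where
  private module K = OrderedField K
  infix 4 _≈_
  field
    Carrier  : Set a
    _≈_      : Rel Carrier ℓ
    d        : Carrier → Carrier → K.Carrier
    isMetric : IsGeneralMetric _≈_ K._≈_ K._≤_ K.0# K._+_ d

  setoid : Setoid a ℓ
  setoid = record { isEquivalence = IsGeneralMetric.≈-isEquivalence isMetric }


module FacilityLocation (K : OrderedField c ℓ₁ ℓ₂) (M : MetricSpace K a ℓ) where
  open OrderedField K renaming (Carrier to 𝕂) public
    using (_+⁺_; _⊓⁺_; _·⁺_; _≤⁺_; fromℕ; 0#)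
  open Probability K public
  open MetricSpace M renaming (Carrier to Point)
  open UniqueSetoid setoid using (Unique)

  dist : List Point → Point → 𝕂 ⁺
  dist F v = foldr (λ u δ → fin (d u v) ⊓⁺ δ) ⊤⁺ F

  size : List Point → 𝕂 ⁺
  size F = fin (fromℕ (length F))

  -- The multiset of demands is the family U 0 , … , U (n - 1).

  cost : ∀ {n} → (Fin n → Point) → List Point → 𝕂 ⁺
  cost U F = size F +⁺ foldr _+⁺_ (fin 0#) (map (dist F) (tabulate U))

  -- Only finite sets need to be compared, since an infinite set of facilities
  -- has infinite cost; a finite set is a list without repetitions.
  record Optimal {n} (U : Fin n → Point) (F : List Point) : Set (c ⊔ ℓ₂ ⊔ a ⊔ ℓ) where
    field
      isSet   : Unique F
      minimum : ∀ F′ → Unique F′ → cost U F ≤⁺ cost U F′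

  -- In the algorithm, F lists the facilities in the order (last to first) in
  -- which they were opened and paid for.  A point already in F is at distance 0,
  -- so it is opened again with probability 0 and length F is almost surely |F|.

  arrive : List Point → Point → Dist (List Point)
  arrive F v = coin (dist F v) >>= λ heads → return (if heads then v ∷ F else F)

  -- Starting from open facilities F, the final facilities together with the
  -- connection cost of the given demands, each charged at its own round.
  rounds : List Point → List Point → Dist (List Point × 𝕂 ⁺)
  rounds F []       = return (F , fin 0#)
  rounds F (v ∷ vs) =
    arrive F v    >>= λ F′ →
    rounds F′ vs  >>= λ (Fₙ , connection) →
    return (Fₙ , dist F′ v +⁺ connection)

  distProb : List Point → Dist (𝕂 ⁺)
  distProb vs = rounds [] vs >>= λ (Fₙ , connection) → return (size Fₙ +⁺ connection)

  ALG : ∀ {n} → (Fin n → Point) → Dist (𝕂 ⁺)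
  ALG {n} U = uniformPermutation n >>= λ σ → distProb (tabulate (λ i → U (σ ⟨$⟩ʳ i)))

{-# OPTIONS --safe #-}

-- Fix the centres F*, and assign each demand to a nearest one.  At any time, let k of the
-- demands of the cluster with centre c be still to arrive, at total distance s from c,
-- and let y = min (1, d(F, c)).  The potential of the cluster is
-- ψ = min (s + k y, 2 + 2 s); the expected cost still to come is at most twice the sum
-- of the potentials: a demand v whose coin has bias p costs at most 2 p in expectation,
-- and averaging over the next arrival pays for it out of both arguments of the minimum.
-- For s + k y this holds arrival by arrival, since p ≤ y + d(c, v).  For 2 + 2 s, a
-- demand at distance d opens a facility with probability at least q = max (y - d, 0), and
-- then the first argument bounds the cost to come; what is left over is Σ q (s - k d) ≥ 0,
-- Chebyshev's inequality, as q decreases with d.  At the start the potentials are at most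
-- 2 + 2 s, whence the factor 4.

module Submission where

open import Defs
open import Algebra.Apartness.Structures using (IsHeytingField)
open import Algebra.Bundles using (CommutativeRing)
import Algebra.Definitions.RawMonoid as RawMonoidDefinitions
import Algebra.Properties.CommutativeSemigroup as CommutativeSemigroupProperties
import Algebra.Properties.Ring as RingProperties
import Algebra.Properties.Semiring.Mult as SemiringMult
import Algebra.Properties.Semiring.Mult.TCOptimised as TCOptimised
import Algebra.Properties.Semiring.Sum as SemiringSum
import Algebra.Solver.Ring as RingSolver
open import Algebra.Solver.Ring.AlmostCommutativeRing using (fromCommutativeRing; _-Raw-AlmostCommutative⟶_)
open import Data.Bool.Base using (Bool; true; false; if_then_else_)
open import Data.Fin.Base using (Fin; zero; suc; punchIn)
open import Data.Fin.Permutation using (Permutation′; _⟨$⟩ʳ_; insert; insert-punchIn)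
open import Data.Fin.Properties using (sequence)
open import Data.Integer.Base as ℤ using (ℤ; +_; -[1+_]; _⊖_; _◃_)
import Data.Integer.Properties as ℤₚ
open import Data.List.Base using (List; []; _∷_; _++_; map; foldr; length; lookup; concatMap; allFin; tabulate)
open import Data.List.Properties using (tabulate-cong)
open import Data.Maybe.Base as Maybe using (Maybe)
open import Data.Nat.Base as ℕ using (ℕ; zero; suc; NonZero; ≢-nonZero⁻¹; _!)
import Data.Nat.Properties as ℕₚ
open import Data.Nat.Properties using (_!≢0)
open import Data.Product.Base using (_×_; _,_; proj₁; proj₂; Σ-syntax)
import Data.Sign.Base as Sign
open import Data.Sum.Base using (_⊎_; inj₁; inj₂; [_,_])
open import Effect.Monad using (RawMonad)
open import Function.Base using (_∘_; id)
open import Function.Metric.Structures using (IsGeneralMetric)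
open import Relation.Binary.Bundles using (Poset)
import Relation.Binary.Construct.Add.Supremum.Equality as SupremumEquality
import Relation.Binary.Construct.Add.Supremum.NonStrict as SupremumOrder
open import Relation.Binary.Lattice.Structures using (IsMeetSemilattice)
open import Relation.Binary.PropositionalEquality as ≡ using (_≡_)
import Relation.Binary.Reasoning.PartialOrder as PosetReasoning
import Relation.Binary.Reasoning.Setoid as SetoidReasoning
open import Relation.Binary.Structures using (IsStrictPartialOrder)
open import Relation.Nullary.Construct.Add.Supremum using (_⁺; ⊤⁺) renaming ([_] to fin)
open import Relation.Nullary.Decidable.Core using (dec⇒maybe)
open import Relation.Nullary.Negation using (¬¬-Monad)
open import Relation.Nullary.Negation.Core using (¬_; contradiction)

-- Arithmetic in an ordered field whose order need not be total.

module OrderedFieldProperties {c ℓ₁ ℓ₂} (K : OrderedField c ℓ₁ ℓ₂) where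
  open OrderedField K renaming (Carrier to 𝕂) public
  open CommutativeRing commutativeRing public
    using (+-cong; +-congˡ; +-congʳ; *-cong; *-congˡ; *-congʳ; -‿cong;
           +-identityˡ; +-identityʳ; *-identityˡ; +-assoc; *-assoc; +-comm; *-comm;
           distribˡ; distribʳ; zeroˡ; zeroʳ; -‿inverseʳ; semiring; ring; setoid)
    renaming (refl to ≈-refl; sym to ≈-sym; trans to ≈-trans; reflexive to ≈-reflexive)
  open SemiringSum semiring public
    using (sum; sum-syntax; sum-cong-≋; sum-remove; ∑-distrib-+; ∑-comm;
           *-distribˡ-sum; *-distribʳ-sum; sum-replicate; sum-replicate-zero)
  private module < = IsStrictPartialOrder isStrictPartialOrder

  poset : Poset _ _ _
  poset = record { isPartialOrder = IsMeetSemilattice.isPartialOrder isMeetSemilattice }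

  open Poset poset public
    using () renaming (refl to ≤-refl; reflexive to ≤-reflexive; trans to ≤-trans; antisym to ≤-antisym)
  open IsMeetSemilattice isMeetSemilattice public
    using () renaming (x∧y≤x to x⊓y≤x; x∧y≤y to x⊓y≤y; ∧-greatest to ⊓-greatest)

  -- Integer coefficients for the ring solver.

  private module IntegerCoefficients where
    open RawMonoidDefinitions +-rawMonoid using (_×′_)
    open SemiringMult semiring using (×-homo-+; ×1-homo-*)
    open TCOptimised semiring using (×ᵤ≈×)
    open RingProperties ring
      using (-0#≈0#; -‿distribˡ-*; -‿distribʳ-*; -‿involutive; -‿+-comm)
    open SetoidReasoning setoid

    -- Chosen so that 0#, 1# and 1# + 1# are literally the images of 0, 1 and 2.
    ⟦_⟧ : ℤ → 𝕂
    ⟦ + n      ⟧ = n ×′ 1#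
    ⟦ -[1+ n ] ⟧ = - (suc n ×′ 1#)

    ⟦+_⟧ : ∀ n → ⟦ + n ⟧ ≈ fromℕ n
    ⟦+ n ⟧ = ≈-sym (×ᵤ≈× n 1#)

    ⟦-[1+_]⟧ : ∀ n → ⟦ -[1+ n ] ⟧ ≈ - fromℕ (suc n)
    ⟦-[1+ n ]⟧ = -‿cong ⟦+ suc n ⟧

    +-medial : ∀ a b c d → a + b + (c + d) ≈ a + c + (b + d)
    +-medial = CommutativeSemigroupProperties.interchange
      (CommutativeRing.+-commutativeSemigroup commutativeRing)

    cancel-1 : ∀ x y → x - y ≈ (1# + x) - (1# + y)
    cancel-1 x y = begin
      x - y                        ≈⟨ +-identityˡ _ ⟨
      0# + (x - y)                 ≈⟨ +-congʳ (-‿inverseʳ 1#) ⟨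
      1# - 1# + (x - y)            ≈⟨ +-medial 1# (- 1#) x (- y) ⟩
      1# + x + (- 1# + - y)        ≈⟨ +-congˡ (-‿+-comm _ _) ⟩
      (1# + x) - (1# + y)          ∎

    ⊖-homo : ∀ m n → ⟦ m ⊖ n ⟧ ≈ fromℕ m - fromℕ n
    ⊖-homo m       zero    = ≈-trans ⟦+ m ⟧ (≈-trans (≈-sym (+-identityʳ _)) (+-congˡ (≈-sym -0#≈0#)))
    ⊖-homo zero    (suc n) = ≈-trans ⟦-[1+ n ]⟧ (≈-sym (+-identityˡ _))
    ⊖-homo (suc m) (suc n) = begin
      ⟦ suc m ⊖ suc n ⟧                  ≡⟨ ≡.cong ⟦_⟧ (ℤₚ.[1+m]⊖[1+n]≡m⊖n m n) ⟩
      ⟦ m ⊖ n ⟧                          ≈⟨ ⊖-homo m n ⟩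
      fromℕ m - fromℕ n                  ≈⟨ cancel-1 _ _ ⟩
      fromℕ (suc m) - fromℕ (suc n)      ∎

    +-homo : ∀ x y → ⟦ x ℤ.+ y ⟧ ≈ ⟦ x ⟧ + ⟦ y ⟧
    +-homo (+ m)    (+ n)    = ≈-trans ⟦+ m ℕ.+ n ⟧
      (≈-trans (×-homo-+ 1# m n) (≈-sym (+-cong ⟦+ m ⟧ ⟦+ n ⟧)))
    +-homo (+ m)    -[1+ n ] = ≈-trans (⊖-homo m (suc n)) (≈-sym (+-cong ⟦+ m ⟧ ⟦-[1+ n ]⟧))
    +-homo -[1+ m ] (+ n)    = ≈-trans (⊖-homo n (suc m))
      (≈-trans (+-comm _ _) (≈-sym (+-cong ⟦-[1+ m ]⟧ ⟦+ n ⟧)))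
    +-homo -[1+ m ] -[1+ n ] = begin
      ⟦ -[1+ suc (m ℕ.+ n) ] ⟧             ≈⟨ ⟦-[1+ suc (m ℕ.+ n) ]⟧ ⟩
      - fromℕ (suc (suc (m ℕ.+ n)))        ≡⟨ ≡.cong (λ k → - fromℕ (suc k)) (ℕₚ.+-suc m n) ⟨
      - fromℕ (suc m ℕ.+ suc n)            ≈⟨ -‿cong (×-homo-+ 1# (suc m) (suc n)) ⟩
      - (fromℕ (suc m) + fromℕ (suc n))    ≈⟨ -‿+-comm _ _ ⟨
      - fromℕ (suc m) - fromℕ (suc n)      ≈⟨ +-cong ⟦-[1+ m ]⟧ ⟦-[1+ n ]⟧ ⟨
      ⟦ -[1+ m ] ⟧ + ⟦ -[1+ n ] ⟧          ∎

    -◃-homo : ∀ n → ⟦ Sign.- ◃ n ⟧ ≈ - fromℕ n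
    -◃-homo zero    = ≈-sym -0#≈0#
    -◃-homo (suc n) = ⟦-[1+ n ]⟧

    *-homo : ∀ x y → ⟦ x ℤ.* y ⟧ ≈ ⟦ x ⟧ * ⟦ y ⟧
    *-homo (+ m)    (+ n)    = begin
      ⟦ Sign.+ ◃ m ℕ.* n ⟧  ≡⟨ ≡.cong ⟦_⟧ (ℤₚ.+◃n≡+n (m ℕ.* n)) ⟩
      ⟦ + (m ℕ.* n) ⟧       ≈⟨ ⟦+ m ℕ.* n ⟧ ⟩
      fromℕ (m ℕ.* n)       ≈⟨ ×1-homo-* m n ⟩
      fromℕ m * fromℕ n     ≈⟨ *-cong ⟦+ m ⟧ ⟦+ n ⟧ ⟨
      ⟦ + m ⟧ * ⟦ + n ⟧     ∎
    *-homo (+ m)    -[1+ n ] = begin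
      ⟦ Sign.- ◃ m ℕ.* suc n ⟧       ≈⟨ -◃-homo (m ℕ.* suc n) ⟩
      - fromℕ (m ℕ.* suc n)          ≈⟨ -‿cong (×1-homo-* m (suc n)) ⟩
      - (fromℕ m * fromℕ (suc n))    ≈⟨ -‿distribʳ-* _ _ ⟩
      fromℕ m * - fromℕ (suc n)      ≈⟨ *-cong ⟦+ m ⟧ ⟦-[1+ n ]⟧ ⟨
      ⟦ + m ⟧ * ⟦ -[1+ n ] ⟧         ∎
    *-homo -[1+ m ] (+ n)    = begin
      ⟦ Sign.- ◃ suc m ℕ.* n ⟧       ≈⟨ -◃-homo (suc m ℕ.* n) ⟩
      - fromℕ (suc m ℕ.* n)          ≈⟨ -‿cong (×1-homo-* (suc m) n) ⟩
      - (fromℕ (suc m) * fromℕ n)    ≈⟨ -‿distribˡ-* _ _ ⟩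
      - fromℕ (suc m) * fromℕ n      ≈⟨ *-cong ⟦-[1+ m ]⟧ ⟦+ n ⟧ ⟨
      ⟦ -[1+ m ] ⟧ * ⟦ + n ⟧         ∎
    *-homo -[1+ m ] -[1+ n ] = begin
      ⟦ + (suc m ℕ.* suc n) ⟧              ≈⟨ ⟦+ suc m ℕ.* suc n ⟧ ⟩
      fromℕ (suc m ℕ.* suc n)              ≈⟨ ×1-homo-* (suc m) (suc n) ⟩
      fromℕ (suc m) * fromℕ (suc n)        ≈⟨ -‿involutive _ ⟨
      - - (fromℕ (suc m) * fromℕ (suc n))  ≈⟨ -‿cong (-‿distribˡ-* _ _) ⟩
      - (- fromℕ (suc m) * fromℕ (suc n))  ≈⟨ -‿distribʳ-* _ _ ⟩
      - fromℕ (suc m) * - fromℕ (suc n)    ≈⟨ *-cong ⟦-[1+ m ]⟧ ⟦-[1+ n ]⟧ ⟨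
      ⟦ -[1+ m ] ⟧ * ⟦ -[1+ n ] ⟧          ∎

    -‿homo : ∀ x → ⟦ ℤ.- x ⟧ ≈ - ⟦ x ⟧
    -‿homo (+ zero)  = ≈-sym -0#≈0#
    -‿homo (+ suc n) = ≈-refl
    -‿homo -[1+ n ]  = ≈-sym (-‿involutive _)

    -- Equality of scalars is not assumed decidable, so the solver normalises with coefficients in
    -- the integers, where it is.
    morphism : CommutativeRing.rawRing ℤₚ.+-*-commutativeRing
               -Raw-AlmostCommutative⟶ fromCommutativeRing commutativeRing
    morphism = record
      { ⟦_⟧    = ⟦_⟧
      ; +-homo = +-homo
      ; *-homo = *-homo
      ; -‿homo = -‿homo
      ; 0-homo = ≈-refl
      ; 1-homo = ≈-refl
      }

    _≟_ : ∀ x y → Maybe (⟦ x ⟧ ≈ ⟦ y ⟧)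
    x ≟ y = Maybe.map (λ { ≡.refl → ≈-refl }) (dec⇒maybe (x ℤₚ.≟ y))

  open RingSolver (CommutativeRing.rawRing ℤₚ.+-*-commutativeRing) (fromCommutativeRing commutativeRing)
    IntegerCoefficients.morphism IntegerCoefficients._≟_ public
    using (solve; con; _:=_; _:+_; _:*_; _:-_; :-_; Polynomial)

  :1 : ∀ {n} → Polynomial n
  :1 = con (+ 1)

  :2 : ∀ {n} → Polynomial n
  :2 = con (+ 2)

  :0 : ∀ {n} → Polynomial n
  :0 = con (+ 0)

  -- Inequalities between scalars.

  module ≤-Reasoning = PosetReasoning poset

  <⇒≤ : ∀ {x y} → x < y → x ≤ y
  <⇒≤ = <.asym

  ¬¬-≤-total : ∀ x y → ¬ ¬ (x ≤ y ⊎ y ≤ x)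
  ¬¬-≤-total x y neither = neither (inj₁ λ y<x → neither (inj₂ (<⇒≤ y<x)))

  -- Although the order is not total, a goal x ≤ y is a negation.
  ≤-cases : ∀ u v {x y} → (u ≤ v → x ≤ y) → (v ≤ u → x ≤ y) → x ≤ y
  ≤-cases u v u≤v⇒ v≤u⇒ y<x = ¬¬-≤-total u v [ (λ u≤v → u≤v⇒ u≤v y<x) , (λ v≤u → v≤u⇒ v≤u y<x) ]

  +-monoˡ-≤ : ∀ z {x y} → x ≤ y → x + z ≤ y + z
  +-monoˡ-≤ z x≤y y+z<x+z = x≤y
    (<.<-respʳ-≈ (cancel _ z) (<.<-respˡ-≈ (cancel _ z) (+-monoˡ-< (- z) y+z<x+z)))
    where
    cancel : ∀ x z → x + z - z ≈ x
    cancel = solve 2 (λ x z → x :+ z :- z := x) ≈-refl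

  +-mono-≤ : ∀ {x y u v} → x ≤ y → u ≤ v → x + u ≤ y + v
  +-mono-≤ {x} {y} {u} {v} x≤y u≤v = begin
    x + u  ≤⟨ +-monoˡ-≤ u x≤y ⟩
    y + u  ≈⟨ +-comm y u ⟩
    u + y  ≤⟨ +-monoˡ-≤ y u≤v ⟩
    v + y  ≈⟨ +-comm v y ⟩
    y + v  ∎
    where open ≤-Reasoning

  ≤⇒0≤- : ∀ {x y} → x ≤ y → 0# ≤ y - x
  ≤⇒0≤- {x} {y} x≤y = begin
    0#     ≈⟨ -‿inverseʳ x ⟨
    x - x  ≤⟨ +-monoˡ-≤ (- x) x≤y ⟩
    y - x  ∎
    where open ≤-Reasoning

  -- The explicit slack `z` turns an inequality into a polynomial identity for the solver plus the
  -- nonnegativity of `z`, which is usually a sum of products of nonnegative differences.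
  ≤-by : ∀ {x y} z → 0# ≤ z → x + z ≈ y → x ≤ y
  ≤-by {x} {y} z 0≤z x+z≈y = begin
    x       ≈⟨ +-identityʳ x ⟨
    x + 0#  ≤⟨ +-mono-≤ ≤-refl 0≤z ⟩
    x + z   ≈⟨ x+z≈y ⟩
    y       ∎
    where open ≤-Reasoning

  0≤+ : ∀ {x y} → 0# ≤ x → 0# ≤ y → 0# ≤ x + y
  0≤+ 0≤x 0≤y = ≤-trans (≤-reflexive (≈-sym (+-identityʳ 0#))) (+-mono-≤ 0≤x 0≤y)

  0≤1 : 0# ≤ 1#
  0≤1 = <⇒≤ 0<1

  -- `*-pos` covers strictly positive factors only. If the product were negative, neither factor
  -- could be zero, so both would be positive up to double negation, contradicting `*-pos`.
  0≤* : ∀ {x y} → 0# ≤ x → 0# ≤ y → 0# ≤ x * y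
  0≤* {x} {y} 0≤x 0≤y = ≤-cases x 0#
    (λ x≤0 → ≤-reflexive (≈-sym (≈-trans (*-congʳ (≤-antisym x≤0 0≤x)) (zeroˡ y))))
    λ _ → ≤-cases y 0#
    (λ y≤0 → ≤-reflexive (≈-sym (≈-trans (*-congˡ (≤-antisym y≤0 0≤y)) (zeroʳ x))))
    λ _ xy<0 → nonzero 0≤x (λ x≈0 → <.irrefl (≈-trans (*-congʳ x≈0) (zeroˡ y)) xy<0)
        λ 0<x → nonzero 0≤y (λ y≈0 → <.irrefl (≈-trans (*-congˡ y≈0) (zeroʳ x)) xy<0)
        λ 0<y → <.asym xy<0 (*-pos 0<x 0<y)
    where
    nonzero : ∀ {z} → 0# ≤ z → ¬ (z ≈ 0#) → ¬ ¬ (0# < z)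
    nonzero 0≤z z≉0 0≮z = z≉0 (≤-antisym 0≮z 0≤z)

  *-monoˡ-≤ : ∀ {z x y} → 0# ≤ z → x ≤ y → z * x ≤ z * y
  *-monoˡ-≤ {z} {x} {y} 0≤z x≤y = ≤-by (z * (y - x)) (0≤* 0≤z (≤⇒0≤- x≤y))
    (solve 3 (λ x y z → z :* x :+ z :* (y :- x) := z :* y) ≈-refl x y z)

  -- Undoes the doubling that symmetrisation causes in `chebyshev`.
  0≤x+x⇒0≤x : ∀ {x} → 0# ≤ x + x → 0# ≤ x
  0≤x+x⇒0≤x {x} 0≤x+x x<0 = 0≤x+x (<.trans
    (<.<-respʳ-≈ (+-identityˡ x) (+-monoˡ-< x x<0)) x<0)

  ⊓-mono-≤ : ∀ {x y u v} → x ≤ y → u ≤ v → x ⊓ u ≤ y ⊓ v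
  ⊓-mono-≤ x≤y u≤v = ⊓-greatest (≤-trans (x⊓y≤x _ _) x≤y) (≤-trans (x⊓y≤y _ _) u≤v)

  -- Finite sums and Chebyshev's inequality.

  sum-mono-≤ : ∀ {n} {f g : Fin n → 𝕂} → (∀ i → f i ≤ g i) → sum f ≤ sum g
  sum-mono-≤ {zero}  f≤g = ≤-refl
  sum-mono-≤ {suc n} f≤g = +-mono-≤ (f≤g zero) (sum-mono-≤ (f≤g ∘ suc))

  0≤sum : ∀ {n} {f : Fin n → 𝕂} → (∀ i → 0# ≤ f i) → 0# ≤ sum f
  0≤sum {zero}  0≤f = ≤-refl
  0≤sum {suc n} 0≤f = 0≤+ (0≤f zero) (0≤sum (0≤f ∘ suc))

  -- Because `u` and `v` do not depend on the index, one of them is the minimum for all summands at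
  -- once. This allows the two arguments of `ψ` to be treated separately, each after summation.
  ≤-sum-⊓ : ∀ n {x u v} → x ≤ ∑[ i < n ] u → x ≤ ∑[ i < n ] v → x ≤ ∑[ i < n ] (u ⊓ v)
  ≤-sum-⊓ n {x} {u} {v} x≤nu x≤nv = ≤-cases u v
    (λ u≤v → ≤-trans x≤nu (sum-mono-≤ {n} λ _ → ⊓-greatest ≤-refl u≤v))
    (λ v≤u → ≤-trans x≤nv (sum-mono-≤ {n} λ _ → ⊓-greatest v≤u ≤-refl))

  -- Symmetrisation: the nonnegative term of the pair (i, j), with weight `w i * w j`, splits into
  -- `X i j + X j i`. For fixed i the sum of `X i j` over j is the i-th term of the claim, so the
  -- double sum over all pairs is twice the claimed one.
  chebyshev : ∀ {n} (w f g : Fin n → 𝕂) → (∀ i → 0# ≤ w i) →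
              (∀ i j → 0# ≤ (f i - f j) * (g j - g i)) →
              0# ≤ ∑[ i < n ] (w i * (f i * (∑[ j < n ] (w j * g j) - sum w * g i)))
  chebyshev {n} w f g 0≤w opposite = 0≤x+x⇒0≤x (begin
    0#
      ≤⟨ 0≤sum (λ i → 0≤sum λ j → 0≤* (0≤* (0≤w i) (0≤w j)) (opposite i j)) ⟩
    ∑[ i < n ] ∑[ j < n ] (w i * w j * ((f i - f j) * (g j - g i)))
      ≈⟨ sum-cong-≋ (λ i → sum-cong-≋ λ j → split (w i) (w j) (f i) (f j) (g i) (g j)) ⟩
    ∑[ i < n ] ∑[ j < n ] (X i j + X j i)
      ≈⟨ sum-cong-≋ (λ i → ∑-distrib-+ (X i) λ j → X j i) ⟩
    ∑[ i < n ] (∑[ j < n ] X i j + ∑[ j < n ] X j i)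
      ≈⟨ ∑-distrib-+ (λ i → ∑[ j < n ] X i j) (λ i → ∑[ j < n ] X j i) ⟩
    (∑[ i < n ] ∑[ j < n ] X i j) + (∑[ i < n ] ∑[ j < n ] X j i)
      ≈⟨ +-congˡ (∑-comm λ i j → X j i) ⟩
    (∑[ i < n ] ∑[ j < n ] X i j) + (∑[ i < n ] ∑[ j < n ] X i j)
      ≈⟨ +-cong (sum-cong-≋ inner) (sum-cong-≋ inner) ⟩
    S + S ∎)
    where
    open ≤-Reasoning
    X : Fin n → Fin n → 𝕂
    X i j = w i * f i * (w j * g j - w j * g i)
    S = ∑[ i < n ] (w i * (f i * (∑[ j < n ] (w j * g j) - sum w * g i)))
    split : ∀ wi wj fi fj gi gj → wi * wj * ((fi - fj) * (gj - gi)) ≈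
            wi * fi * (wj * gj - wj * gi) + wj * fj * (wi * gi - wi * gj)
    split = solve 6 (λ wi wj fi fj gi gj → wi :* wj :* ((fi :- fj) :* (gj :- gi)) :=
            wi :* fi :* (wj :* gj :- wj :* gi) :+ wj :* fj :* (wi :* gi :- wi :* gj)) ≈-refl
    inner : ∀ i → ∑[ j < n ] X i j ≈ w i * (f i * (∑[ j < n ] (w j * g j) - sum w * g i))
    inner i = begin-equality
      ∑[ j < n ] X i j
        ≈⟨ *-distribˡ-sum (w i * f i) (λ j → w j * g j - w j * g i) ⟨
      w i * f i * ∑[ j < n ] (w j * g j - w j * g i)
        ≈⟨ *-congˡ (sum-cong-≋ λ j → +-congˡ (solve 2 (λ w g → :- (w :* g) := w :* :- g) ≈-refl (w j) (g i))) ⟩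
      w i * f i * ∑[ j < n ] (w j * g j + w j * - g i)
        ≈⟨ *-congˡ (∑-distrib-+ (λ j → w j * g j) (λ j → w j * - g i)) ⟩
      w i * f i * (∑[ j < n ] (w j * g j) + ∑[ j < n ] (w j * - g i))
        ≈⟨ *-congˡ (+-congˡ (*-distribʳ-sum (- g i) w)) ⟨
      w i * f i * (∑[ j < n ] (w j * g j) + sum w * - g i)
        ≈⟨ solve 5 (λ w f s k g → w :* f :* (s :+ k :* :- g) := w :* (f :* (s :- k :* g)))
             ≈-refl (w i) (f i) _ (sum w) (g i) ⟩
      w i * (f i * (∑[ j < n ] (w j * g j) - sum w * g i)) ∎

  -- The potential of one cluster and a single arrival.

  𝟙 : Bool → 𝕂
  𝟙 true  = 1#
  𝟙 false = 0#

  mix : 𝕂 → 𝕂 → 𝕂 → 𝕂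
  mix p x y = p * x + (1# - p) * y

  0≤𝟙 : ∀ b → 0# ≤ 𝟙 b
  0≤𝟙 true  = 0≤1
  0≤𝟙 false = ≤-refl

  mix-mono-≤ : ∀ {p x x′ y y′} → 0# ≤ p → p ≤ 1# → x ≤ x′ → y ≤ y′ → mix p x y ≤ mix p x′ y′
  mix-mono-≤ 0≤p p≤1 x≤x′ y≤y′ =
    +-mono-≤ (*-monoˡ-≤ 0≤p x≤x′) (*-monoˡ-≤ (≤⇒0≤- p≤1) y≤y′)

  mix-idem : ∀ p x → mix p x x ≈ x
  mix-idem = solve 2 (λ p x → p :* x :+ (:1 :- p) :* x := x) ≈-refl

  ψ : 𝕂 → 𝕂 → 𝕂 → 𝕂
  ψ k s y = (s + k * y) ⊓ (1# + 1# + (s + s))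

  -- A demand with coin bias `p` arrives at distance `d` from the centre, and a Boolean `b` tells
  -- whether it belongs to the cluster. `k` and `s` count only the demands left after it; `y` is the
  -- capped distance of the centre from the open facilities, and `y′` the one after opening at the
  -- demand.
  module _ {p y y′ d k s : 𝕂} (0≤p : 0# ≤ p) (p≤1 : p ≤ 1#) (0≤k : 0# ≤ k) (y′≤y : y′ ≤ y) where
    -- Opening only lowers `y`, so both outcomes of the coin leave at most `s + k * y`. The demand's
    -- own share `p ≤ y + d` is what its departure from the cluster releases.
    ψ-step-linear : ∀ b → (b ≡ true → p ≤ y + d) →
      𝟙 b * p + mix p (ψ k s y′) (ψ k s y) ≤ (𝟙 b * d + s) + (𝟙 b + k) * y
    ψ-step-linear b p≤y+d = begin
      𝟙 b * p + mix p (ψ k s y′) (ψ k s y)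
        ≤⟨ +-mono-≤ (own b p≤y+d) (mix-mono-≤ 0≤p p≤1
             (≤-trans (x⊓y≤x _ _) (+-mono-≤ ≤-refl (*-monoˡ-≤ 0≤k y′≤y))) (x⊓y≤x _ _)) ⟩
      𝟙 b * (y + d) + mix p (s + k * y) (s + k * y)
        ≈⟨ +-congˡ (mix-idem p _) ⟩
      𝟙 b * (y + d) + (s + k * y)
        ≈⟨ solve 5 (λ b y d k s → b :* (y :+ d) :+ (s :+ k :* y) := b :* d :+ s :+ (b :+ k) :* y)
             ≈-refl (𝟙 b) y d k s ⟩
      (𝟙 b * d + s) + (𝟙 b + k) * y ∎
      where
      open ≤-Reasoning
      own : ∀ b → (b ≡ true → p ≤ y + d) → 𝟙 b * p ≤ 𝟙 b * (y + d)
      own true  p≤y+d = *-monoˡ-≤ 0≤1 (p≤y+d ≡.refl)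
      own false _     = ≤-reflexive (≈-trans (zeroˡ p) (≈-sym (zeroˡ _)))

    -- The extra term on the left is what a single arrival cannot pay for: q (S - K d), where q =
    -- max (y - d, 0) and S, K are the cost and size of the cluster before the arrival. Its sum over
    -- all possible arrivals is handled by `chebyshev`.
    ψ-step-const : ∀ b → (b ≡ true → p ≤ y + d × y ≤ p + d × y′ ≤ d) →
      (𝟙 b * p + mix p (ψ k s y′) (ψ k s y)) +
        𝟙 b * ((y - d ⊓ y) * ((𝟙 b * d + s) - (𝟙 b + k) * d)) ≤
      1# + 1# + ((𝟙 b * d + s) + (𝟙 b * d + s))
    ψ-step-const false _ = ≤-by
      (p * (1# + 1# + (s + s) - ψ k s y′) + (1# - p) * (1# + 1# + (s + s) - ψ k s y))
      (0≤+ (0≤* 0≤p (≤⇒0≤- (x⊓y≤y _ _))) (0≤* (≤⇒0≤- p≤1) (≤⇒0≤- (x⊓y≤y _ _))))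
      (solve 8 (λ p q d s k y Ψ′ Ψ →
          :0 :* p :+ (p :* Ψ′ :+ (:1 :- p) :* Ψ) :+ :0 :* (q :* ((:0 :* d :+ s) :- (:0 :+ k) :* d))
            :+ (p :* (:2 :+ (s :+ s) :- Ψ′) :+ (:1 :- p) :* (:2 :+ (s :+ s) :- Ψ))
          := :2 :+ ((:0 :* d :+ s) :+ (:0 :* d :+ s)))
        ≈-refl p (y - d ⊓ y) d s k y (ψ k s y′) (ψ k s y))
    ψ-step-const true hyp with p≤y+d , y≤p+d , y′≤d ← hyp ≡.refl = ≤-by
      -- With q = y - m, the coin is cut into three parts: on a part q of heads the potential is
      -- bounded by its first argument at `y′ ≤ d`, on the remaining p - q of heads and on tails by
      -- `2 + 2 s`. The last three slacks say p ≤ y + d ≤ 2 q + 2 d.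
      ((y - m) * (s + k * d - ψ k s y′)
        + (p - (y - m)) * (1# + 1# + (s + s) - ψ k s y′)
        + (1# - p) * (1# + 1# + (s + s) - ψ k s y)
        + (y + d - p) + (d - m) + (y - m))
      (0≤+ (0≤+ (0≤+ (0≤+ (0≤+
        (0≤* (≤⇒0≤- (x⊓y≤y d y)) (≤⇒0≤- (≤-trans (x⊓y≤x _ _) (+-mono-≤ ≤-refl (*-monoˡ-≤ 0≤k y′≤d)))))
        (0≤* (≤⇒0≤- q≤p) (≤⇒0≤- (x⊓y≤y _ _))))
        (0≤* (≤⇒0≤- p≤1) (≤⇒0≤- (x⊓y≤y _ _))))
        (≤⇒0≤- p≤y+d)) (≤⇒0≤- (x⊓y≤x d y))) (≤⇒0≤- (x⊓y≤y d y)))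
      (solve 8 (λ p m d s k y Ψ′ Ψ →
          :1 :* p :+ (p :* Ψ′ :+ (:1 :- p) :* Ψ) :+ :1 :* ((y :- m) :* ((:1 :* d :+ s) :- (:1 :+ k) :* d))
            :+ ((y :- m) :* (s :+ k :* d :- Ψ′) :+ (p :- (y :- m)) :* (:2 :+ (s :+ s) :- Ψ′)
                :+ (:1 :- p) :* (:2 :+ (s :+ s) :- Ψ) :+ (y :+ d :- p) :+ (d :- m) :+ (y :- m))
          := :2 :+ ((:1 :* d :+ s) :+ (:1 :* d :+ s)))
        ≈-refl p m d s k y (ψ k s y′) (ψ k s y))
      where
      m = d ⊓ y
      -- For `d ≤ y` the minimum `m` is `d`, and `y ≤ p + d` applies; otherwise `m` is `y` and the
      -- left side vanishes.
      q≤p : y - m ≤ p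
      q≤p = ≤-cases d y
        (λ d≤y → ≤-by ((p + d - y) + (m - d))
          (0≤+ (≤⇒0≤- y≤p+d) (≤⇒0≤- (⊓-greatest ≤-refl d≤y)))
          (solve 4 (λ y m p d → y :- m :+ ((p :+ d :- y) :+ (m :- d)) := p) ≈-refl y m p d))
        (λ y≤d → ≤-by (p + (m - y))
          (0≤+ 0≤p (≤⇒0≤- (⊓-greatest y≤d ≤-refl)))
          (solve 3 (λ y m p → y :- m :+ (p :+ (m :- y)) := p) ≈-refl y m p))

-- One cluster, summed over all choices of the next arrival.

module Cluster {c ℓ₁ ℓ₂} (K : OrderedField c ℓ₁ ℓ₂) where
  open OrderedFieldProperties K

  module _ {n} (b : Fin (suc n) → Bool) (d p y′ : Fin (suc n) → 𝕂) (y : 𝕂) where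
    private
      k = ∑[ j < suc n ] 𝟙 (b j)
      s = ∑[ j < suc n ] (𝟙 (b j) * d j)
      k⁻ s⁻ : Fin (suc n) → 𝕂
      k⁻ j = ∑[ i < n ] 𝟙 (b (punchIn j i))
      s⁻ j = ∑[ i < n ] (𝟙 (b (punchIn j i)) * d (punchIn j i))

    -- The first argument of `ψ` dominates for each arrival separately. The second does so only in
    -- total: the bound for a single `j` carries the correction `X j` of varying sign, and the
    -- corrections sum to something nonnegative by `chebyshev`, because `y - d j ⊓ y` decreases as
    -- `d j` grows.
    ψ-step : (∀ j → 0# ≤ p j) → (∀ j → p j ≤ 1#) → (∀ j → y′ j ≤ y) →
             (∀ j → b j ≡ true → p j ≤ y + d j × y ≤ p j + d j × y′ j ≤ d j) →
             ∑[ j < suc n ] (𝟙 (b j) * p j + mix (p j) (ψ (k⁻ j) (s⁻ j) (y′ j)) (ψ (k⁻ j) (s⁻ j) y)) ≤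
             ∑[ j < suc n ] ψ k s y
    ψ-step 0≤p p≤1 y′≤y near = ≤-sum-⊓ (suc n) (sum-mono-≤ linear) constant
      where
      open ≤-Reasoning
      T X : Fin (suc n) → 𝕂
      T j = 𝟙 (b j) * p j + mix (p j) (ψ (k⁻ j) (s⁻ j) (y′ j)) (ψ (k⁻ j) (s⁻ j) y)
      X j = 𝟙 (b j) * ((y - d j ⊓ y) * (s - k * d j))

      k≈ : ∀ j → k ≈ 𝟙 (b j) + k⁻ j
      k≈ j = sum-remove {i = j} (𝟙 ∘ b)

      s≈ : ∀ j → s ≈ 𝟙 (b j) * d j + s⁻ j
      s≈ j = sum-remove {i = j} (λ i → 𝟙 (b i) * d i)

      0≤k⁻ : ∀ j → 0# ≤ k⁻ j
      0≤k⁻ j = 0≤sum (λ i → 0≤𝟙 (b (punchIn j i)))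

      linear : ∀ j → T j ≤ s + k * y
      linear j = begin
        T j
          ≤⟨ ψ-step-linear (0≤p j) (p≤1 j) (0≤k⁻ j) (y′≤y j) (b j) (proj₁ ∘ near j) ⟩
        (𝟙 (b j) * d j + s⁻ j) + (𝟙 (b j) + k⁻ j) * y
          ≈⟨ +-cong (s≈ j) (*-congʳ (k≈ j)) ⟨
        s + k * y ∎

      const-bound : ∀ j → T j + X j ≤ 1# + 1# + (s + s)
      const-bound j = begin
        T j + X j
          ≈⟨ +-congˡ (*-congˡ (*-congˡ (+-cong (s≈ j) (-‿cong (*-congʳ (k≈ j)))))) ⟩
        T j + 𝟙 (b j) * ((y - d j ⊓ y) * ((𝟙 (b j) * d j + s⁻ j) - (𝟙 (b j) + k⁻ j) * d j))
          ≤⟨ ψ-step-const (0≤p j) (p≤1 j) (0≤k⁻ j) (y′≤y j) (b j) (near j) ⟩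
        1# + 1# + ((𝟙 (b j) * d j + s⁻ j) + (𝟙 (b j) * d j + s⁻ j))
          ≈⟨ +-congˡ (+-cong (s≈ j) (s≈ j)) ⟨
        1# + 1# + (s + s) ∎

      antitone : ∀ i j → 0# ≤ ((y - d i ⊓ y) - (y - d j ⊓ y)) * (d j - d i)
      antitone i j = ≤-cases (d i) (d j)
        (λ di≤dj → ≤-trans
          (0≤* (≤⇒0≤- (⊓-mono-≤ di≤dj ≤-refl)) (≤⇒0≤- di≤dj))
          (≤-reflexive (solve 5 (λ y mi mj di dj →
              (mj :- mi) :* (dj :- di) := ((y :- mi) :- (y :- mj)) :* (dj :- di))
            ≈-refl y (d i ⊓ y) (d j ⊓ y) (d i) (d j))))
        (λ dj≤di → ≤-trans
          (0≤* (≤⇒0≤- (⊓-mono-≤ dj≤di ≤-refl)) (≤⇒0≤- dj≤di))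
          (≤-reflexive (solve 5 (λ y mi mj di dj →
              (mi :- mj) :* (di :- dj) := ((y :- mi) :- (y :- mj)) :* (dj :- di))
            ≈-refl y (d i ⊓ y) (d j ⊓ y) (d i) (d j))))

      constant : sum T ≤ ∑[ j < suc n ] (1# + 1# + (s + s))
      constant = begin
        sum T
          ≤⟨ ≤-by (sum X) (chebyshev (𝟙 ∘ b) (λ i → y - d i ⊓ y) d (0≤𝟙 ∘ b) antitone) ≈-refl ⟩
        sum T + sum X
          ≈⟨ ∑-distrib-+ T X ⟨
        ∑[ j < suc n ] (T j + X j)
          ≤⟨ sum-mono-≤ const-bound ⟩
        ∑[ j < suc n ] (1# + 1# + (s + s)) ∎

-- Sums over lists and over all permutations.

module ListSum {c ℓ₁ ℓ₂} (K : OrderedField c ℓ₁ ℓ₂) where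
  open OrderedFieldProperties K
  open SetoidReasoning setoid

  module _ {a} {A : Set a} where
    sumₗ : List A → (A → 𝕂) → 𝕂
    sumₗ xs f = foldr (λ x s → f x + s) 0# xs

    sumₗ-cong : ∀ xs {f g : A → 𝕂} → (∀ x → f x ≈ g x) → sumₗ xs f ≈ sumₗ xs g
    sumₗ-cong []       f≈g = ≈-refl
    sumₗ-cong (x ∷ xs) f≈g = +-cong (f≈g x) (sumₗ-cong xs f≈g)

    sumₗ-mono-≤ : ∀ xs {f g : A → 𝕂} → (∀ x → f x ≤ g x) → sumₗ xs f ≤ sumₗ xs g
    sumₗ-mono-≤ []       f≤g = ≤-refl
    sumₗ-mono-≤ (x ∷ xs) f≤g = +-mono-≤ (f≤g x) (sumₗ-mono-≤ xs f≤g)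

    sumₗ-++ : ∀ xs ys (f : A → 𝕂) → sumₗ (xs ++ ys) f ≈ sumₗ xs f + sumₗ ys f
    sumₗ-++ []       ys f = ≈-sym (+-identityˡ _)
    sumₗ-++ (x ∷ xs) ys f = ≈-trans (+-congˡ (sumₗ-++ xs ys f)) (≈-sym (+-assoc _ _ _))

    sumₗ-const : ∀ xs x → sumₗ xs (λ _ → x) ≈ fromℕ (length xs) * x
    sumₗ-const []       x = ≈-sym (zeroˡ x)
    sumₗ-const (_ ∷ xs) x = begin
      x + sumₗ xs (λ _ → x)           ≈⟨ +-cong (≈-sym (*-identityˡ x)) (sumₗ-const xs x) ⟩
      1# * x + fromℕ (length xs) * x  ≈⟨ distribʳ x 1# _ ⟨
      (1# + fromℕ (length xs)) * x    ∎

    sumₗ-mix : ∀ xs w p (f g : A → 𝕂) →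
               sumₗ xs (λ x → w + mix p (f x) (g x)) ≈ sumₗ xs (λ _ → w) + mix p (sumₗ xs f) (sumₗ xs g)
    sumₗ-mix []       w p f g = solve 1 (λ p → :0 := :0 :+ (p :* :0 :+ (:1 :- p) :* :0)) ≈-refl p
    sumₗ-mix (x ∷ xs) w p f g = ≈-trans (+-congˡ (sumₗ-mix xs w p f g))
      (solve 7 (λ w p f g w′ f′ g′ →
          w :+ (p :* f :+ (:1 :- p) :* g) :+ (w′ :+ (p :* f′ :+ (:1 :- p) :* g′)) :=
          w :+ w′ :+ (p :* (f :+ f′) :+ (:1 :- p) :* (g :+ g′)))
        ≈-refl w p (f x) (g x) _ _ _)

    sumₗ-∑-comm : ∀ xs {n} (f : A → Fin n → 𝕂) →
                  sumₗ xs (λ x → ∑[ j < n ] f x j) ≈ ∑[ j < n ] sumₗ xs (λ x → f x j)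
    sumₗ-∑-comm []       {n} f = ≈-sym (sum-replicate-zero n)
    sumₗ-∑-comm (x ∷ xs) {n} f = ≈-trans (+-congˡ (sumₗ-∑-comm xs f))
      (≈-sym (∑-distrib-+ (f x) λ j → sumₗ xs (λ x → f x j)))

    sumₗ-tabulate : ∀ {n} (g : Fin n → A) (f : A → 𝕂) → sumₗ (tabulate g) f ≈ ∑[ j < n ] f (g j)
    sumₗ-tabulate {zero}  g f = ≈-refl
    sumₗ-tabulate {suc n} g f = +-congˡ (sumₗ-tabulate (g ∘ suc) f)

  module _ {a b} {A : Set a} {B : Set b} where
    sumₗ-map : ∀ (g : A → B) xs (f : B → 𝕂) → sumₗ (map g xs) f ≈ sumₗ xs (f ∘ g)
    sumₗ-map g []       f = ≈-refl
    sumₗ-map g (x ∷ xs) f = +-congˡ (sumₗ-map g xs f)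

    sumₗ-concatMap : ∀ (g : A → List B) xs (f : B → 𝕂) →
                     sumₗ (concatMap g xs) f ≈ sumₗ xs (λ x → sumₗ (g x) f)
    sumₗ-concatMap g []       f = ≈-refl
    sumₗ-concatMap g (x ∷ xs) f =
      ≈-trans (sumₗ-++ (g x) (concatMap g xs) f) (+-congˡ (sumₗ-concatMap g xs f))

  -- Conditioning on the first arrival: `insert zero j` puts demand `j` first and orders the others
  -- by a permutation of one element fewer.
  sumₗ-permutations : ∀ n (f : Permutation′ (suc n) → 𝕂) →
    sumₗ (permutations (suc n)) f ≈ ∑[ j < suc n ] sumₗ (permutations n) (f ∘ insert zero j)
  sumₗ-permutations n f = begin
    sumₗ (permutations (suc n)) f
      ≈⟨ sumₗ-concatMap (λ j → map (insert zero j) (permutations n)) (allFin (suc n)) f ⟩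
    sumₗ (allFin (suc n)) (λ j → sumₗ (map (insert zero j) (permutations n)) f)
      ≈⟨ sumₗ-cong (allFin (suc n)) (λ j → sumₗ-map (insert zero j) (permutations n) f) ⟩
    sumₗ (allFin (suc n)) (λ j → sumₗ (permutations n) (f ∘ insert zero j))
      ≈⟨ sumₗ-tabulate id (λ j → sumₗ (permutations n) (f ∘ insert zero j)) ⟩
    ∑[ j < suc n ] sumₗ (permutations n) (f ∘ insert zero j) ∎

-- The total potential and the induction over arrivals.

module Potential {c ℓ₁ ℓ₂ a ℓ} (K : OrderedField c ℓ₁ ℓ₂) (M : MetricSpace K a ℓ) where
  open OrderedFieldProperties K
  open Cluster K
  open ListSum K
  open MetricSpace M using (d) renaming (Carrier to Point)
  open IsGeneralMetric (MetricSpace.isMetric M) using (triangle) renaming (sym to d-sym; nonNegative to 0≤d)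

  -- The bias of the coin. Starting the fold at 1 keeps the value finite and gives the right bias 1
  -- when no facility is open.
  tdist : List Point → Point → 𝕂
  tdist F v = foldr (λ u δ → d u v ⊓ δ) 1# F

  tdist≤1 : ∀ F v → tdist F v ≤ 1#
  tdist≤1 []      v = ≤-refl
  tdist≤1 (u ∷ F) v = ≤-trans (x⊓y≤y _ _) (tdist≤1 F v)

  0≤tdist : ∀ F v → 0# ≤ tdist F v
  0≤tdist []      v = 0≤1
  0≤tdist (u ∷ F) v = ⊓-greatest 0≤d (0≤tdist F v)

  tdist-lipschitz : ∀ F v w → tdist F v ≤ tdist F w + d w v
  tdist-lipschitz []      v w = ≤-by (d w v) 0≤d ≈-refl
  tdist-lipschitz (u ∷ F) v w = ≤-cases (d u w) (tdist F w)
    (λ du≤t → ≤-trans (≤-trans (x⊓y≤x _ _) (triangle u w v)) (+-mono-≤ (⊓-greatest ≤-refl du≤t) ≤-refl))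
    (λ t≤du → ≤-trans (≤-trans (x⊓y≤y _ _) (tdist-lipschitz F v w)) (+-mono-≤ (⊓-greatest t≤du ≤-refl) ≤-refl))

  -- Bounds the expected cost still to come for a fixed arrival order: each demand is charged twice
  -- its bias, `p` for opening and `p` for the expected connection cost, and the coin then decides
  -- the facilities for the rest.
  bound : List Point → List Point → 𝕂
  bound F []       = 0#
  bound F (v ∷ vs) = (p + p) + mix p (bound (v ∷ F) vs) (bound F vs)
    where p = tdist F v

  module _ {m} (C : Fin m → Point) where
    clusterSize : ∀ {n} → (Fin n → Fin m → Bool) → Fin m → 𝕂
    clusterSize {n} e c = ∑[ j < n ] 𝟙 (e j c)

    clusterCost : ∀ {n} → (Fin n → Point) → (Fin n → Fin m → Bool) → Fin m → 𝕂
    clusterCost {n} U e c = ∑[ j < n ] (𝟙 (e j c) * d (C c) (U j))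

    Φ : ∀ {n} → List Point → (Fin n → Point) → (Fin n → Fin m → Bool) → 𝕂
    Φ F U e = ∑[ c < m ] ψ (clusterSize e c) (clusterCost U e c) (tdist F (C c))

    0≤clusterCost : ∀ {n} (U : Fin n → Point) e c → 0# ≤ clusterCost U e c
    0≤clusterCost U e c = 0≤sum λ j → 0≤* (0≤𝟙 (e j c)) 0≤d

    0≤Φ : ∀ {n} F (U : Fin n → Point) e → 0# ≤ Φ F U e
    0≤Φ F U e = 0≤sum λ c → ⊓-greatest
      (0≤+ (0≤clusterCost U e c) (0≤* (0≤sum λ j → 0≤𝟙 (e j c)) (0≤tdist F (C c))))
      (0≤+ (0≤+ 0≤1 0≤1) (0≤+ (0≤clusterCost U e c) (0≤clusterCost U e c)))

    -- As the indicators of each demand sum to 1, its charge `p j` can be distributed over the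
    -- clusters, landing in its own one. After exchanging the two sums, `ψ-step` applies to each
    -- cluster; its metric conditions are the Lipschitz property of `tdist` in both directions and
    -- the fact that a new facility at `U j` is at distance `d` from the centre.
    Φ-step : ∀ {n} F (U : Fin (suc n) → Point) (e : Fin (suc n) → Fin m → Bool) →
      (∀ j → ∑[ c < m ] 𝟙 (e j c) ≈ 1#) →
      ∑[ j < suc n ] (tdist F (U j) + mix (tdist F (U j))
          (Φ (U j ∷ F) (U ∘ punchIn j) (e ∘ punchIn j)) (Φ F (U ∘ punchIn j) (e ∘ punchIn j))) ≤
      ∑[ j < suc n ] Φ F U e
    Φ-step {n} F U e partition = begin
      ∑[ j < suc n ] (p j + mix (p j) (∑[ c < m ] A j c) (∑[ c < m ] B j c))
        ≈⟨ sum-cong-≋ distribute ⟩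
      ∑[ j < suc n ] ∑[ c < m ] (𝟙 (e j c) * p j + mix (p j) (A j c) (B j c))
        ≈⟨ ∑-comm (λ j c → 𝟙 (e j c) * p j + mix (p j) (A j c) (B j c)) ⟩
      ∑[ c < m ] ∑[ j < suc n ] (𝟙 (e j c) * p j + mix (p j) (A j c) (B j c))
        ≤⟨ sum-mono-≤ (λ c → ψ-step (λ j → e j c) (λ j → d (C c) (U j)) p
             (λ j → tdist (U j ∷ F) (C c)) (tdist F (C c))
             (λ j → 0≤tdist F (U j)) (λ j → tdist≤1 F (U j)) (λ j → x⊓y≤y _ _)
             (λ j _ → tdist-lipschitz F (U j) (C c)
                    , ≤-trans (tdist-lipschitz F (C c) (U j)) (+-mono-≤ ≤-refl (≤-reflexive (d-sym _ _)))
                    , ≤-trans (x⊓y≤x _ _) (≤-reflexive (d-sym _ _)))) ⟩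
      ∑[ c < m ] ∑[ j < suc n ] ψ (clusterSize e c) (clusterCost U e c) (tdist F (C c))
        ≈⟨ ∑-comm {m} {suc n} (λ c j → ψ (clusterSize e c) (clusterCost U e c) (tdist F (C c))) ⟩
      ∑[ j < suc n ] Φ F U e ∎
      where
      open ≤-Reasoning
      p : Fin (suc n) → 𝕂
      p j = tdist F (U j)
      A B : Fin (suc n) → Fin m → 𝕂
      A j c = ψ (clusterSize (e ∘ punchIn j) c) (clusterCost (U ∘ punchIn j) (e ∘ punchIn j) c)
                (tdist (U j ∷ F) (C c))
      B j c = ψ (clusterSize (e ∘ punchIn j) c) (clusterCost (U ∘ punchIn j) (e ∘ punchIn j) c)
                (tdist F (C c))
      distribute : ∀ j → p j + mix (p j) (∑[ c < m ] A j c) (∑[ c < m ] B j c) ≈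
                   ∑[ c < m ] (𝟙 (e j c) * p j + mix (p j) (A j c) (B j c))
      distribute j = begin-equality
        p j + mix (p j) (sum (A j)) (sum (B j))
          ≈⟨ +-cong (*-identityˡ (p j))
                    (+-cong (≈-sym (*-distribˡ-sum (p j) (A j))) (≈-sym (*-distribˡ-sum (1# - p j) (B j)))) ⟨
        1# * p j + (∑[ c < m ] (p j * A j c) + ∑[ c < m ] ((1# - p j) * B j c))
          ≈⟨ +-cong (≈-trans (≈-sym (*-distribʳ-sum (p j) λ c → 𝟙 (e j c))) (*-congʳ (partition j)))
                    (∑-distrib-+ (λ c → p j * A j c) (λ c → (1# - p j) * B j c)) ⟨
        ∑[ c < m ] (𝟙 (e j c) * p j) + ∑[ c < m ] mix (p j) (A j c) (B j c)
          ≈⟨ ∑-distrib-+ (λ c → 𝟙 (e j c) * p j) (λ c → mix (p j) (A j c) (B j c)) ⟨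
        ∑[ c < m ] (𝟙 (e j c) * p j + mix (p j) (A j c) (B j c)) ∎

    -- Induction on the number of demands, for all `F` at once since the coin changes `F`. Both
    -- sides are sums over permutations instead of averages, so that no division occurs in the
    -- induction.
    bound≤2Φ : ∀ n F (U : Fin n → Point) (e : Fin n → Fin m → Bool) →
      (∀ j → ∑[ c < m ] 𝟙 (e j c) ≈ 1#) →
      sumₗ (permutations n) (λ σ → bound F (tabulate (λ i → U (σ ⟨$⟩ʳ i)))) ≤
      sumₗ (permutations n) (λ _ → Φ F U e + Φ F U e)
    bound≤2Φ zero    F U e _ = +-mono-≤ (0≤+ (0≤Φ F U e) (0≤Φ F U e)) ≤-refl
    bound≤2Φ (suc n) F U e partition = begin
      sumₗ (permutations (suc n)) (λ σ → bound F (tabulate (λ i → U (σ ⟨$⟩ʳ i))))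
        ≈⟨ sumₗ-permutations n (λ σ → bound F (tabulate (λ i → U (σ ⟨$⟩ʳ i)))) ⟩
      ∑[ j < suc n ] sumₗ P (λ σ → bound F (tabulate (λ i → U (insert zero j σ ⟨$⟩ʳ i))))
        ≈⟨ sum-cong-≋ (λ j → sumₗ-cong P λ σ → ≈-reflexive (≡.cong (bound F ∘ (U j ∷_))
             (tabulate-cong λ i → ≡.cong U (insert-punchIn zero j σ i)))) ⟩
      ∑[ j < suc n ] sumₗ P (λ σ → (p j + p j) + mix (p j) (bound (U j ∷ F) (rest j σ)) (bound F (rest j σ)))
        ≈⟨ sum-cong-≋ (λ j → sumₗ-mix P (p j + p j) (p j)
             (λ σ → bound (U j ∷ F) (rest j σ)) (λ σ → bound F (rest j σ))) ⟩
      ∑[ j < suc n ] (sumₗ P (λ _ → p j + p j) +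
                      mix (p j) (sumₗ P (λ σ → bound (U j ∷ F) (rest j σ))) (sumₗ P (λ σ → bound F (rest j σ))))
        ≤⟨ sum-mono-≤ (λ j → +-mono-≤ (≤-refl {sumₗ P (λ _ → p j + p j)})
             (mix-mono-≤ (0≤tdist F (U j)) (tdist≤1 F (U j))
             (bound≤2Φ n (U j ∷ F) (U ∘ punchIn j) (e ∘ punchIn j) (partition ∘ punchIn j))
             (bound≤2Φ n F (U ∘ punchIn j) (e ∘ punchIn j) (partition ∘ punchIn j)))) ⟩
      ∑[ j < suc n ] (sumₗ P (λ _ → p j + p j) +
                      mix (p j) (sumₗ P (λ _ → opened j + opened j)) (sumₗ P (λ _ → kept j + kept j)))
        ≈⟨ sum-cong-≋ (λ j → sumₗ-mix P (p j + p j) (p j) (λ _ → opened j + opened j) (λ _ → kept j + kept j)) ⟨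
      ∑[ j < suc n ] sumₗ P (λ _ → (p j + p j) + mix (p j) (opened j + opened j) (kept j + kept j))
        ≈⟨ sum-cong-≋ (λ j → sumₗ-cong P λ _ → double (p j) (opened j) (kept j)) ⟩
      ∑[ j < suc n ] sumₗ P (λ _ → next j + next j)
        ≈⟨ sumₗ-∑-comm P (λ _ j → next j + next j) ⟨
      sumₗ P (λ _ → ∑[ j < suc n ] (next j + next j))
        ≈⟨ sumₗ-cong P (λ _ → ∑-distrib-+ next next) ⟩
      sumₗ P (λ _ → sum next + sum next)
        -- `Φ-step` holds only for the sum over the first arrival; that sum has therefore been moved
        -- inside the one over orders of the remaining demands, whose terms have become constant.
        ≤⟨ sumₗ-mono-≤ P (λ _ → +-mono-≤ (Φ-step F U e partition) (Φ-step F U e partition)) ⟩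
      sumₗ P (λ _ → ∑[ j < suc n ] Φ F U e + ∑[ j < suc n ] Φ F U e)
        ≈⟨ sumₗ-cong P (λ _ → ∑-distrib-+ {suc n} (λ _ → Φ F U e) (λ _ → Φ F U e)) ⟨
      sumₗ P (λ _ → ∑[ j < suc n ] (Φ F U e + Φ F U e))
        ≈⟨ sumₗ-∑-comm P {suc n} (λ _ _ → Φ F U e + Φ F U e) ⟩
      ∑[ j < suc n ] sumₗ P (λ _ → Φ F U e + Φ F U e)
        ≈⟨ sumₗ-permutations n (λ _ → Φ F U e + Φ F U e) ⟨
      sumₗ (permutations (suc n)) (λ _ → Φ F U e + Φ F U e) ∎
      where
      open ≤-Reasoning
      P = permutations n
      p opened kept next : Fin (suc n) → 𝕂
      p j = tdist F (U j)
      opened j = Φ (U j ∷ F) (U ∘ punchIn j) (e ∘ punchIn j)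
      kept j = Φ F (U ∘ punchIn j) (e ∘ punchIn j)
      next j = p j + mix (p j) (opened j) (kept j)
      rest : Fin (suc n) → Permutation′ n → List Point
      rest j σ = tabulate (λ i → U (punchIn j (σ ⟨$⟩ʳ i)))
      double : ∀ p x y → (p + p) + mix p (x + x) (y + y) ≈ (p + mix p x y) + (p + mix p x y)
      double = solve 3 (λ p x y → (p :+ p) :+ (p :* (x :+ x) :+ (:1 :- p) :* (y :+ y)) :=
                                  (p :+ (p :* x :+ (:1 :- p) :* y)) :+ (p :+ (p :* x :+ (:1 :- p) :* y))) ≈-refl

-- Reciprocals of positive integers.

module Inverse {c ℓ₁ ℓ₂} (K : OrderedField c ℓ₁ ℓ₂) where
  open OrderedFieldProperties K

  1/n*n≈1 : ∀ n .{{_ : NonZero n}} → (1/ n) * fromℕ n ≈ 1#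
  -- A Heyting field inverts the difference of two apart elements, here n - 0.
  1/n*n≈1 n = ≈-trans (*-congˡ (solve 1 (λ k → k := k :- :0) ≈-refl (fromℕ n)))
    (proj₁ (proj₂ (IsHeytingField.#⇒invertible isHeytingField (inj₂ (0<fromℕ n)))))

  0≤1/ : ∀ n .{{_ : NonZero n}} → 0# ≤ 1/ n
  0≤1/ n w<0 = 1≤0 0<1
    where
    open ≤-Reasoning
    1≤0 : 1# ≤ 0#
    1≤0 = begin
      1#                ≈⟨ 1/n*n≈1 n ⟨
      (1/ n) * fromℕ n  ≈⟨ *-comm _ _ ⟩
      fromℕ n * (1/ n)  ≤⟨ *-monoˡ-≤ (<⇒≤ (0<fromℕ n)) (<⇒≤ w<0) ⟩
      fromℕ n * 0#      ≈⟨ zeroʳ _ ⟩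
      0#                ∎

-- Extended scalars and expectations.

module Extended {c ℓ₁ ℓ₂} (K : OrderedField c ℓ₁ ℓ₂) where
  open OrderedFieldProperties K
  open ListSum K
  open SupremumEquality _≈_ using (_≈⁺_; [_]; ⊤⁺≈⊤⁺)
  open SupremumOrder _≤_ using ([_]; _≤⊤⁺)
  open Probability K

  poset⁺ : Poset _ _ _
  poset⁺ = record { isPartialOrder = SupremumOrder.≤⁺-isPartialOrder _≤_ (Poset.isPartialOrder poset) }

  open Poset poset⁺ public
    using () renaming (reflexive to ≤⁺-reflexive; trans to ≤⁺-trans)
  open Poset.Eq poset⁺ public
    using ()
    renaming (refl to ≈⁺-refl; sym to ≈⁺-sym; trans to ≈⁺-trans; reflexive to ≈⁺-reflexive;
              setoid to setoid⁺)
  module ≤⁺-Reasoning = PosetReasoning poset⁺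

  +⁺-cong : ∀ {x y u v} → x ≈⁺ y → u ≈⁺ v → x +⁺ u ≈⁺ y +⁺ v
  +⁺-cong ⊤⁺≈⊤⁺ _       = ⊤⁺≈⊤⁺
  +⁺-cong [ _ ] ⊤⁺≈⊤⁺   = ⊤⁺≈⊤⁺
  +⁺-cong [ x≈y ] [ u≈v ] = [ +-cong x≈y u≈v ]

  +⁺-mono-≤⁺ : ∀ {x y u v} → x ≤⁺ y → u ≤⁺ v → x +⁺ u ≤⁺ y +⁺ v
  +⁺-mono-≤⁺ {y = ⊤⁺}     _ _ = _ ≤⊤⁺
  +⁺-mono-≤⁺ {y = fin _} {v = ⊤⁺} _ _ = _ ≤⊤⁺
  +⁺-mono-≤⁺ {y = fin _} {v = fin _} [ x≤y ] [ u≤v ] = [ +-mono-≤ x≤y u≤v ]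

  +⁺-assoc : ∀ x y z → (x +⁺ y) +⁺ z ≈⁺ x +⁺ (y +⁺ z)
  +⁺-assoc ⊤⁺      _       _       = ⊤⁺≈⊤⁺
  +⁺-assoc (fin _) ⊤⁺      _       = ⊤⁺≈⊤⁺
  +⁺-assoc (fin _) (fin _) ⊤⁺      = ⊤⁺≈⊤⁺
  +⁺-assoc (fin x) (fin y) (fin z) = [ +-assoc x y z ]

  +⁺-identityˡ : ∀ x → fin 0# +⁺ x ≈⁺ x
  +⁺-identityˡ ⊤⁺      = ⊤⁺≈⊤⁺
  +⁺-identityˡ (fin x) = [ +-identityˡ x ]

  +⁺-identityʳ : ∀ x → x +⁺ fin 0# ≈⁺ x
  +⁺-identityʳ ⊤⁺      = ⊤⁺≈⊤⁺
  +⁺-identityʳ (fin x) = [ +-identityʳ x ]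

  ·⁺-cong : ∀ k {x y} → x ≈⁺ y → k ·⁺ x ≈⁺ k ·⁺ y
  ·⁺-cong k ⊤⁺≈⊤⁺   = ⊤⁺≈⊤⁺
  ·⁺-cong k [ x≈y ] = [ *-congˡ x≈y ]

  ·⁺-mono-≤⁺ : ∀ {k x y} → 0# ≤ k → x ≤⁺ y → k ·⁺ x ≤⁺ k ·⁺ y
  ·⁺-mono-≤⁺ 0≤k [ x≤y ]  = [ *-monoˡ-≤ 0≤k x≤y ]
  ·⁺-mono-≤⁺ 0≤k (_ ≤⊤⁺)  = _ ≤⊤⁺

  ·⁺-assoc : ∀ k l x → (k * l) ·⁺ x ≈⁺ k ·⁺ (l ·⁺ x)
  ·⁺-assoc k l ⊤⁺      = ⊤⁺≈⊤⁺
  ·⁺-assoc k l (fin x) = [ *-assoc k l x ]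

  ·⁺-identityˡ : ∀ x → 1# ·⁺ x ≈⁺ x
  ·⁺-identityˡ ⊤⁺      = ⊤⁺≈⊤⁺
  ·⁺-identityˡ (fin x) = [ *-identityˡ x ]

  ·⁺-distribˡ-+⁺ : ∀ k x y → k ·⁺ (x +⁺ y) ≈⁺ k ·⁺ x +⁺ k ·⁺ y
  ·⁺-distribˡ-+⁺ k ⊤⁺      y       = ⊤⁺≈⊤⁺
  ·⁺-distribˡ-+⁺ k (fin x) ⊤⁺      = ⊤⁺≈⊤⁺
  ·⁺-distribˡ-+⁺ k (fin x) (fin y) = [ distribˡ k x y ]

  module _ {a} {A : Set a} where
    -- Expectation of a function of the outcome, which unlike `𝔼` can be pushed through `_>>=_`; `𝔼`
    -- is the case of the identity.
    𝔼[_] : Dist A → (A → 𝕂 ⁺) → 𝕂 ⁺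
    𝔼[ D ] g = foldr (λ (p , x) s → p ·⁺ g x +⁺ s) (fin 0#) D

    𝔼-cong : ∀ D {g h : A → 𝕂 ⁺} → (∀ x → g x ≈⁺ h x) → 𝔼[ D ] g ≈⁺ 𝔼[ D ] h
    𝔼-cong []            g≈h = ≈⁺-refl
    𝔼-cong ((p , x) ∷ D) g≈h = +⁺-cong (·⁺-cong p (g≈h x)) (𝔼-cong D g≈h)

    𝔼-++ : ∀ D D′ (g : A → 𝕂 ⁺) → 𝔼[ D ++ D′ ] g ≈⁺ 𝔼[ D ] g +⁺ 𝔼[ D′ ] g
    𝔼-++ []            D′ g = ≈⁺-sym (+⁺-identityˡ _)
    𝔼-++ ((p , x) ∷ D) D′ g = ≈⁺-trans (+⁺-cong ≈⁺-refl (𝔼-++ D D′ g)) (≈⁺-sym (+⁺-assoc (p ·⁺ g x) _ _))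

    𝔼-scale : ∀ k D (g : A → 𝕂 ⁺) → 𝔼[ map (λ (q , y) → k * q , y) D ] g ≈⁺ k ·⁺ 𝔼[ D ] g
    𝔼-scale k []            g = [ ≈-sym (zeroʳ k) ]
    𝔼-scale k ((q , y) ∷ D) g = ≈⁺-trans (+⁺-cong (·⁺-assoc k q (g y)) (𝔼-scale k D g))
      (≈⁺-sym (·⁺-distribˡ-+⁺ k (q ·⁺ g y) _))

    𝔼-return : ∀ x (g : A → 𝕂 ⁺) → 𝔼[ return x ] g ≈⁺ g x
    𝔼-return x g = ≈⁺-trans (+⁺-identityʳ _) (·⁺-identityˡ (g x))

    𝔼-uniform-≤ : ∀ {w} xs {g : A → 𝕂 ⁺} {f} → 0# ≤ w → (∀ x → g x ≤⁺ fin (f x)) →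
                  𝔼[ map (w ,_) xs ] g ≤⁺ fin (w * sumₗ xs f)
    𝔼-uniform-≤ {w} []       0≤w g≤f = [ ≤-reflexive (≈-sym (zeroʳ w)) ]
    𝔼-uniform-≤ {w} (x ∷ xs) 0≤w g≤f = ≤⁺-trans
      (+⁺-mono-≤⁺ (·⁺-mono-≤⁺ 0≤w (g≤f x)) (𝔼-uniform-≤ xs 0≤w g≤f))
      [ ≤-reflexive (≈-sym (distribˡ w _ _)) ]

  𝔼->>= : ∀ {a b} {A : Set a} {B : Set b} (m : Dist A) (f : A → Dist B) (g : B → 𝕂 ⁺) →
          𝔼[ m >>= f ] g ≈⁺ 𝔼[ m ] (λ x → 𝔼[ f x ] g)
  𝔼->>= []            f g = ≈⁺-refl
  𝔼->>= ((p , x) ∷ m) f g = ≈⁺-trans (𝔼-++ (map _ (f x)) (m >>= f) g)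
    (+⁺-cong (𝔼-scale p (f x) g) (𝔼->>= m f g))

  𝔼-coin-≤ : ∀ δ (h : Bool → 𝕂 ⁺) {x y} → 0# ≤ δ → h true ≤⁺ fin x → h false ≤⁺ fin y →
             𝔼[ coin (fin δ) ] h ≤⁺ fin (mix (δ ⊓ 1#) x y)
  𝔼-coin-≤ δ h 0≤δ hₜ hf = +⁺-mono-≤⁺ (·⁺-mono-≤⁺ (⊓-greatest 0≤δ 0≤1) hₜ)
    (≤⁺-trans (≤⁺-reflexive (+⁺-identityʳ _)) (·⁺-mono-≤⁺ (≤⇒0≤- (x⊓y≤y δ 1#)) hf))

-- The cost of DistProb for a fixed arrival order.

module Rounds {c ℓ₁ ℓ₂ a ℓ} (K : OrderedField c ℓ₁ ℓ₂) (M : MetricSpace K a ℓ) where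
  open Inverse K
  open Cluster K
  open OrderedFieldProperties K
  open ListSum K
  open Extended K
  open Potential K M
  open Probability K
  open SupremumEquality _≈_ using (_≈⁺_; [_]; ⊤⁺≈⊤⁺)
  open SupremumOrder _≤_ using ([_]; _≤⊤⁺)
  open FacilityLocation K M using (dist; size; cost; arrive; rounds; distProb; ALG)
  open MetricSpace M using (d) renaming (Carrier to Point)
  open IsGeneralMetric (MetricSpace.isMetric M)
    using (≈⇒0) renaming (nonNegative to 0≤d)

  -- Separating the head of a nonempty list of facilities keeps the distance a finite scalar.
  near : Point → List Point → Point → 𝕂
  near u []      v = d u v
  near u (w ∷ F) v = d u v ⊓ near w F v

  dist-near : ∀ u F v → dist (u ∷ F) v ≡ fin (near u F v)
  dist-near u []      v = ≡.refl
  dist-near u (w ∷ F) v = ≡.cong (fin (d u v) ⊓⁺_) (dist-near w F v)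

  0≤near : ∀ u F v → 0# ≤ near u F v
  0≤near u []      v = 0≤d
  0≤near u (w ∷ F) v = ⊓-greatest 0≤d (0≤near w F v)

  near⊓1≤tdist : ∀ u F v → near u F v ⊓ 1# ≤ tdist (u ∷ F) v
  near⊓1≤tdist u []      v = ≤-refl
  near⊓1≤tdist u (w ∷ F) v = ⊓-greatest (≤-trans (x⊓y≤x _ _) (x⊓y≤x _ _))
    (≤-trans (⊓-mono-≤ (x⊓y≤y _ _) ≤-refl) (near⊓1≤tdist w F v))

  tdist≤near⊓1 : ∀ u F v → tdist (u ∷ F) v ≤ near u F v ⊓ 1#
  tdist≤near⊓1 u []      v = ≤-refl
  tdist≤near⊓1 u (w ∷ F) v = ⊓-greatest
    (⊓-mono-≤ ≤-refl (≤-trans (tdist≤near⊓1 w F v) (x⊓y≤x _ _)))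
    (tdist≤1 (u ∷ w ∷ F) v)

  near⊓1≈tdist : ∀ u F v → near u F v ⊓ 1# ≈ tdist (u ∷ F) v
  near⊓1≈tdist u F v = ≤-antisym (near⊓1≤tdist u F v) (tdist≤near⊓1 u F v)

  d-refl≤0 : ∀ v → d v v ≤ 0#
  d-refl≤0 v = ≤-reflexive (≈⇒0 (IsGeneralMetric.EqC.refl (MetricSpace.isMetric M)))

  -- For `δ ≤ 1` the bias is δ itself and 1 - δ is at most 1; for `1 ≤ δ` tails has probability 0.
  tails-cost : ∀ {δ} → 0# ≤ δ → (1# - δ ⊓ 1#) * δ ≤ δ ⊓ 1#
  tails-cost {δ} 0≤δ = ≤-cases δ 1#
    (λ δ≤1 → ≤-by (δ ⊓ 1# * δ + (δ ⊓ 1# - δ)) (0≤+ (0≤* 0≤p 0≤δ) (≤⇒0≤- (⊓-greatest ≤-refl δ≤1)))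
      (solve 2 (λ p δ → (:1 :- p) :* δ :+ (p :* δ :+ (p :- δ)) := p) ≈-refl (δ ⊓ 1#) δ))
    (λ 1≤δ → ≤-by ((δ ⊓ 1# - 1#) * δ + δ ⊓ 1#) (0≤+ (0≤* (≤⇒0≤- (⊓-greatest 1≤δ ≤-refl)) 0≤δ) 0≤p)
      (solve 2 (λ p δ → (:1 :- p) :* δ :+ ((p :- :1) :* δ :+ p) := p) ≈-refl (δ ⊓ 1#) δ))
    where
    0≤p : 0# ≤ δ ⊓ 1#
    0≤p = ⊓-greatest 0≤δ 0≤1

  -- `s` accumulates the connection cost of earlier rounds, which the induction over rounds has to
  -- carry along.
  charge : 𝕂 → List Point × 𝕂 ⁺ → 𝕂 ⁺
  charge s (F , connection) = size F +⁺ (fin s +⁺ connection)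

  chargeAfter : 𝕂 → List Point → Point → List Point → 𝕂 ⁺
  chargeAfter s F v vs = 𝔼[ rounds F vs ] (λ (Fₙ , connection) → charge s (Fₙ , dist F v +⁺ connection))

  𝔼-rounds-∷ : ∀ s F v vs →
    𝔼[ rounds F (v ∷ vs) ] (charge s) ≈⁺
    𝔼[ coin (dist F v) ] (λ heads → chargeAfter s (if heads then v ∷ F else F) v vs)
  𝔼-rounds-∷ s F v vs = begin
    𝔼[ rounds F (v ∷ vs) ] (charge s)
      ≈⟨ 𝔼->>= (arrive F v) after (charge s) ⟩
    𝔼[ arrive F v ] (λ F′ → 𝔼[ after F′ ] (charge s))
      ≈⟨ 𝔼-cong (arrive F v) (λ F′ → ≈⁺-trans
           (𝔼->>= (rounds F′ vs) (λ (Fₙ , connection) → return (Fₙ , dist F′ v +⁺ connection)) (charge s))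
           (𝔼-cong (rounds F′ vs) λ (Fₙ , connection) → 𝔼-return (Fₙ , dist F′ v +⁺ connection) (charge s))) ⟩
    𝔼[ arrive F v ] h
      ≈⟨ 𝔼->>= (coin (dist F v)) (λ heads → return (if heads then v ∷ F else F)) h ⟩
    𝔼[ coin (dist F v) ] (λ heads → 𝔼[ return (if heads then v ∷ F else F) ] h)
      ≈⟨ 𝔼-cong (coin (dist F v)) (λ heads → 𝔼-return (if heads then v ∷ F else F) h) ⟩
    𝔼[ coin (dist F v) ] (λ heads → h (if heads then v ∷ F else F)) ∎
    where
    open SetoidReasoning setoid⁺
    after : List Point → Dist (List Point × 𝕂 ⁺)
    after F′ = rounds F′ vs >>= λ (Fₙ , connection) → return (Fₙ , dist F′ v +⁺ connection)
    h : List Point → 𝕂 ⁺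
    h F′ = chargeAfter s F′ v vs

  -- Induction over the rounds. The facilities already open and `s` are paid in full; the next
  -- demand pays 1 on heads and its distance on tails, in expectation at most twice its bias.
  𝔼-rounds-≤ : ∀ s F vs → 𝔼[ rounds F vs ] (charge s) ≤⁺ fin (fromℕ (length F) + s + bound F vs)

  -- The distance just charged is moved into the accumulator by associativity, and the induction
  -- hypothesis takes over.
  𝔼-rounds-charged : ∀ s F v vs {x} → dist F v ≡ fin x →
    chargeAfter s F v vs ≤⁺
    fin (fromℕ (length F) + (s + x) + bound F vs)
  𝔼-rounds-charged s F v vs {x} eq = ≤⁺-trans (≤⁺-reflexive (𝔼-cong (rounds F vs) λ (Fₙ , connection) →
      +⁺-cong (≈⁺-refl {size Fₙ}) (≈⁺-trans
        (≈⁺-reflexive (≡.cong (λ δ → fin s +⁺ (δ +⁺ connection)) eq))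
        (≈⁺-sym (+⁺-assoc (fin s) (fin x) connection)))))
    (𝔼-rounds-≤ (s + x) F vs)

  𝔼-rounds-≤ s F [] = ≤⁺-trans (≤⁺-reflexive (𝔼-return (F , fin 0#) (charge s)))
    [ ≤-reflexive (≈-sym (+-assoc _ _ _)) ]
  𝔼-rounds-≤ s [] (v ∷ vs) = begin
    𝔼[ rounds [] (v ∷ vs) ] (charge s)
      -- With no facility open the distance is ∞, and `coin` lists heads alone.
      ≈⟨ ≈⁺-trans (𝔼-rounds-∷ s [] v vs)
           (𝔼-return true (λ heads → chargeAfter s (if heads then v ∷ [] else []) v vs)) ⟩
    chargeAfter s (v ∷ []) v vs
      ≤⟨ 𝔼-rounds-charged s (v ∷ []) v vs ≡.refl ⟩
    fin ((1# + 0#) + (s + d v v) + bound (v ∷ []) vs)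
      -- The first facility costs 1 where `bound` charges 2, and its demand connects at distance 0.
      ≤⟨ [ ≤-by (1# + (0# - d v v)) (0≤+ 0≤1 (≤⇒0≤- (d-refl≤0 v)))
             (solve 4 (λ s e b b₀ → (:1 :+ :0) :+ (s :+ e) :+ b :+ (:1 :+ (:0 :- e)) :=
                          :0 :+ s :+ ((:1 :+ :1) :+ (:1 :* b :+ (:1 :- :1) :* b₀)))
               ≈-refl s (d v v) (bound (v ∷ []) vs) (bound [] vs)) ] ⟩
    fin (0# + s + bound [] (v ∷ vs)) ∎
    where open ≤⁺-Reasoning
  𝔼-rounds-≤ s F@(u ∷ F₀) (v ∷ vs) = begin
    𝔼[ rounds F (v ∷ vs) ] (charge s)
      ≈⟨ 𝔼-rounds-∷ s F v vs ⟩
    𝔼[ coin (dist F v) ] h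
      ≡⟨ ≡.cong (λ δ → 𝔼[ coin δ ] h) (dist-near u F₀ v) ⟩
    𝔼[ coin (fin δ) ] h
      ≤⟨ 𝔼-coin-≤ δ h (0≤near u F₀ v)
           (𝔼-rounds-charged s (v ∷ F) v vs (dist-near v F v))
           (𝔼-rounds-charged s F v vs (dist-near u F₀ v)) ⟩
    fin (mix (δ ⊓ 1#) ((1# + k) + (s + (d v v ⊓ δ)) + b₁) (k + (s + δ) + b₀))
      -- On heads the connection cost is at most 0; on tails `tails-cost` bounds its contribution by
      -- the bias. The other copy of the bias pays for the opening.
      ≤⟨ [ ≤-by ((δ ⊓ 1#) * (0# - (d v v ⊓ δ)) + (δ ⊓ 1# - (1# - δ ⊓ 1#) * δ))
             (0≤+ (0≤* (⊓-greatest (0≤near u F₀ v) 0≤1) (≤⇒0≤- (≤-trans (x⊓y≤x _ _) (d-refl≤0 v))))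
                  (≤⇒0≤- (tails-cost (0≤near u F₀ v))))
             (solve 7 (λ p k s e b₁ b₀ δ →
                 p :* ((:1 :+ k) :+ (s :+ e) :+ b₁) :+ (:1 :- p) :* (k :+ (s :+ δ) :+ b₀)
                   :+ (p :* (:0 :- e) :+ (p :- (:1 :- p) :* δ))
                 := k :+ s :+ ((p :+ p) :+ (p :* b₁ :+ (:1 :- p) :* b₀)))
               ≈-refl (δ ⊓ 1#) k s (d v v ⊓ δ) b₁ b₀ δ) ] ⟩
    fin (k + s + ((δ ⊓ 1# + δ ⊓ 1#) + mix (δ ⊓ 1#) b₁ b₀))
      ≈⟨ [ +-congˡ (+-cong (+-cong p≈ p≈) (+-cong (*-congʳ p≈) (*-congʳ (+-congˡ (-‿cong p≈))))) ] ⟩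
    fin (k + s + bound F (v ∷ vs)) ∎
    where
    open ≤⁺-Reasoning
    δ = near u F₀ v
    k = fromℕ (length F)
    b₁ = bound (v ∷ F) vs
    b₀ = bound F vs
    p≈ = near⊓1≈tdist u F₀ v
    h : Bool → 𝕂 ⁺
    h heads = chargeAfter s (if heads then v ∷ F else F) v vs

  𝔼-distProb-≤ : ∀ vs → 𝔼 (distProb vs) ≤⁺ fin (bound [] vs)
  𝔼-distProb-≤ vs = begin
    𝔼 (distProb vs)
      ≈⟨ 𝔼->>= (rounds [] vs) (λ (Fₙ , connection) → return (size Fₙ +⁺ connection)) id ⟩
    𝔼[ rounds [] vs ] (λ (Fₙ , connection) → 𝔼 (return (size Fₙ +⁺ connection)))
      ≈⟨ 𝔼-cong (rounds [] vs) (λ (Fₙ , connection) → ≈⁺-trans (𝔼-return (size Fₙ +⁺ connection) id)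
           (+⁺-cong (≈⁺-refl {size Fₙ}) (≈⁺-sym (+⁺-identityˡ connection)))) ⟩
    𝔼[ rounds [] vs ] (charge 0#)
      ≤⟨ 𝔼-rounds-≤ 0# [] vs ⟩
    fin (0# + 0# + bound [] vs)
      ≈⟨ [ solve 1 (λ b → :0 :+ :0 :+ b := b) ≈-refl (bound [] vs) ] ⟩
    fin (bound [] vs) ∎
    where open ≤⁺-Reasoning

  -- Nearest centres and the initial potential.

  -- The chosen centre is encoded by its indicator vector, the form in which `Φ` takes the clusters.
  NearestCentre : Point → List Point → Point → Set _
  NearestCentre u F v = Σ[ e ∈ (Fin (suc (length F)) → Bool) ]
    (∑[ c < suc (length F) ] 𝟙 (e c) ≈ 1#) ×
    (∑[ c < suc (length F) ] (𝟙 (e c) * d (lookup (u ∷ F) c) v) ≤ near u F v)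

  -- A nearest centre cannot be selected effectively, the order being undecidable.
  nearest : ∀ u F v → ¬ ¬ NearestCentre u F v
  nearest u []      v none = none
    ( (λ _ → true)
    , +-identityʳ 1#
    , ≤-reflexive (≈-trans (+-identityʳ _) (*-identityˡ _)))
  nearest u (w ∷ F) v none = nearest w F v λ (e , sum≈1 , cost≤near) →
    ¬¬-≤-total (d u v) (near w F v) λ
      { (inj₁ u-nearer) → none
        ( (λ { zero → true ; (suc _) → false })
        , ≈-trans (+-congˡ (sum-replicate-zero (suc (length F)))) (+-identityʳ 1#)
        , ≤-trans (≤-reflexive (≈-trans
            (+-cong (*-identityˡ (d u v))
              (≈-trans (sum-cong-≋ (λ c → zeroˡ (d (lookup (w ∷ F) c) v))) (sum-replicate-zero (suc (length F)))))
            (+-identityʳ (d u v))))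
            (⊓-greatest ≤-refl u-nearer))
      ; (inj₂ u-farther) → none
        ( (λ { zero → false ; (suc c) → e c })
        , ≈-trans (+-identityˡ _) sum≈1
        , ≤-trans (≤-reflexive (≈-trans (+-congʳ (zeroˡ (d u v))) (+-identityˡ _)))
            (≤-trans cost≤near (⊓-greatest u-farther ≤-refl)))
      }

  connection-near : ∀ {n} u F (U : Fin n → Point) →
    foldr _+⁺_ (fin 0#) (map (dist (u ∷ F)) (tabulate U)) ≡ fin (∑[ i < n ] near u F (U i))
  connection-near {zero}  u F U = ≡.refl
  connection-near {suc n} u F U = ≡.cong₂ _+⁺_ (dist-near u F (U zero)) (connection-near u F (U ∘ suc))

  -- Each potential is at most its second argument, so centres and connection costs both enter `Φ`
  -- with factor 2, and `Φ` is taken twice.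
  2Φ≤4cost : ∀ {n} u F (U : Fin n → Point) (A : ∀ i → NearestCentre u F (U i)) →
    let e = proj₁ ∘ A ; C = lookup (u ∷ F) in
    Φ C [] U e + Φ C [] U e ≤ fromℕ 4 * (fromℕ (suc (length F)) + ∑[ i < n ] near u F (U i))
  2Φ≤4cost {n} u F U A = begin
    Φ C [] U e + Φ C [] U e
      ≤⟨ +-mono-≤ Φ≤ Φ≤ ⟩
    (k + k + (N + N)) + (k + k + (N + N))
      ≈⟨ solve 2 (λ k N → (k :+ k :+ (N :+ N)) :+ (k :+ k :+ (N :+ N)) :=
                          (:1 :+ (:1 :+ (:1 :+ (:1 :+ :0)))) :* (k :+ N)) ≈-refl k N ⟩
    fromℕ 4 * (k + N) ∎
    where
    open ≤-Reasoning
    m = suc (length F)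
    C = lookup (u ∷ F)
    e : Fin n → Fin m → Bool
    e = proj₁ ∘ A
    k = fromℕ m
    N = ∑[ i < n ] near u F (U i)
    S : Fin m → 𝕂
    S = clusterCost C U e

    ∑S≤N : sum S ≤ N
    ∑S≤N = begin
      ∑[ c < m ] ∑[ i < n ] (𝟙 (e i c) * d (C c) (U i))  ≈⟨ ∑-comm (λ c i → 𝟙 (e i c) * d (C c) (U i)) ⟩
      ∑[ i < n ] ∑[ c < m ] (𝟙 (e i c) * d (C c) (U i))  ≤⟨ sum-mono-≤ (λ i → proj₂ (proj₂ (A i))) ⟩
      N                                                  ∎

    Φ≤ : Φ C [] U e ≤ k + k + (N + N)
    Φ≤ = begin
      Φ C [] U e
        ≤⟨ sum-mono-≤ {m} (λ c → x⊓y≤y (S c + clusterSize C e c * 1#) (1# + 1# + (S c + S c))) ⟩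
      ∑[ c < m ] (1# + 1# + (S c + S c))
        ≈⟨ ≈-trans (∑-distrib-+ {m} (λ _ → 1# + 1#) (λ c → S c + S c))
             (+-cong (∑-distrib-+ {m} (λ _ → 1#) (λ _ → 1#)) (∑-distrib-+ S S)) ⟩
      ∑[ c < m ] 1# + ∑[ c < m ] 1# + (sum S + sum S)
        ≤⟨ +-mono-≤ (≤-reflexive (+-cong (sum-replicate m) (sum-replicate m))) (+-mono-≤ ∑S≤N ∑S≤N) ⟩
      k + k + (N + N) ∎

  -- Averaging over the arrival orders, and the competitive ratio.

  arrivals : ∀ {n} → (Fin n → Point) → Permutation′ n → List Point
  arrivals U σ = tabulate (λ i → U (σ ⟨$⟩ʳ i))

  averageBound : ∀ {n} → (Fin n → Point) → 𝕂
  averageBound {n} U = (1/ (n !)) {{n !≢0}} * sumₗ (permutations n) (λ σ → bound [] (arrivals U σ))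

  𝔼-ALG-≤ : ∀ {n} (U : Fin n → Point) → 𝔼 (ALG U) ≤⁺ fin (averageBound U)
  𝔼-ALG-≤ {n} U = ≤⁺-trans
    (≤⁺-reflexive (𝔼->>= (uniformPermutation n) (distProb ∘ arrivals U) id))
    (𝔼-uniform-≤ (permutations n) (0≤1/ (n !) {{n !≢0}}) (λ σ → 𝔼-distProb-≤ (arrivals U σ)))

  averageBound≤2Φ : ∀ {n} (U : Fin n → Point) {m} (C : Fin m → Point) (e : Fin n → Fin m → Bool) →
    (∀ i → ∑[ c < m ] 𝟙 (e i c) ≈ 1#) → averageBound U ≤ Φ C [] U e + Φ C [] U e
  averageBound≤2Φ {n} U C e partition = begin
    averageBound U
      ≤⟨ *-monoˡ-≤ (0≤1/ (n !) {{n !≢0}}) (bound≤2Φ C n [] U e partition) ⟩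
    w * sumₗ (permutations n) (λ _ → X)
      ≈⟨ *-congˡ (sumₗ-const (permutations n) X) ⟩
    w * (fromℕ (length (permutations n)) * X)
      ≡⟨ ≡.cong (λ k → w * (fromℕ k * X)) (length-permutations n) ⟩
    w * (fromℕ (n !) * X)
      ≈⟨ *-assoc w (fromℕ (n !)) X ⟨
    w * fromℕ (n !) * X
      ≈⟨ *-congʳ (1/n*n≈1 (n !) {{n !≢0}}) ⟩
    1# * X
      ≈⟨ *-identityˡ X ⟩
    X ∎
    where
    open ≤-Reasoning
    w = (1/ (n !)) {{n !≢0}}
    X = Φ C [] U e + Φ C [] U e

  averageBound≤4cost : ∀ {n} u F (U : Fin n → Point) →
    averageBound U ≤ fromℕ 4 * (fromℕ (suc (length F)) + ∑[ i < n ] near u F (U i))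
  averageBound≤4cost u F U exceeds =
    -- Each nearest centre exists only up to double negation. As there are finitely many demands,
    -- the choices can be made jointly under one double negation, and that suffices because the goal
    -- is itself a negation, with `exceeds` the assumption to be refuted.
    sequence (RawMonad.rawApplicative ¬¬-Monad) (λ i → nearest u F (U i)) λ A →
    ≤-trans (averageBound≤2Φ U (lookup (u ∷ F)) (proj₁ ∘ A) (proj₁ ∘ proj₂ ∘ A)) (2Φ≤4cost u F U A) exceeds

  competitive : ∀ {n} u F (U : Fin n → Point) → 𝔼 (ALG U) ≤⁺ fromℕ 4 ·⁺ cost U (u ∷ F)
  competitive {n} u F U = begin
    𝔼 (ALG U)
      ≤⟨ 𝔼-ALG-≤ U ⟩
    fin (averageBound U)
      ≤⟨ [ averageBound≤4cost u F U ] ⟩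
    fin (fromℕ 4 * (fromℕ (suc (length F)) + ∑[ i < n ] near u F (U i)))
      ≡⟨ ≡.cong (λ x → fromℕ 4 ·⁺ (size (u ∷ F) +⁺ x)) (connection-near u F U) ⟨
    fromℕ 4 ·⁺ cost U (u ∷ F) ∎
    where open ≤⁺-Reasoning

theorem3p6 : ∀ {c ℓ₁ ℓ₂ a ℓ} (K : OrderedField c ℓ₁ ℓ₂) (M : MetricSpace K a ℓ) →
    let open FacilityLocation K M in
    (n : ℕ) .{{_ : NonZero n}} (U : Fin n → MetricSpace.Carrier M)
    (F* : List (MetricSpace.Carrier M)) → Optimal U F* →
    𝔼 (ALG U) ≤⁺ fromℕ 4 ·⁺ cost U F*
theorem3p6 K M zero    U []      _ = contradiction ≡.refl (≢-nonZero⁻¹ 0)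
-- Without a facility the first demand is at distance ∞, so the right side is ∞.
theorem3p6 K M (suc n) U []      _ = _ SupremumOrder.≤⊤⁺
theorem3p6 K M n       U (u ∷ F) _ = Rounds.competitive K M u F U
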